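{- Let $n\ge 3$ and $k\ge 1$ be integers and let $T(n,k)$ be the tadpole graph. Then $\gamma_{\rm SMB}(T(n,k))=\infty$ and $$\gamma'_{\rm SMB}(T(n,k))=\begin{cases}\lceil \log_2(n+k+\sigma(n))\rceil & \text{if } n \text{ is even and } k \text{ is odd},\\ \infty & \text{otherwise},\end{cases}$$ where $\sigma(n)=\frac{2^{\lceil \log_2 n\rceil}-n}{2}+1$.
   Context: The tadpole graph $T(n,k)$ ($n\ge 3$, $k\ge1$) is obtained from an $n$-cycle $v_0v_1\dots v_{n-1}v_0$ and a vertex-disjoint path $u_1\dots u_k$ by adding the edge $v_0u_k$. All graphs are finite and simple; $N_G[v]$ is the closed neighborhood of $v$. The Maker-Breaker domination game on a graph $G$ is played by Dominator and Staller, who alternately play a vertex not played before. Dominator wins if the set of vertices he has played is a dominating set of $G$; Staller wins if she has played all vertices of $N_G[v]$ for some $v\in V(G)$. In the D-game Dominator moves first, in the S-game Staller moves first. $\gamma_{\rm SMB}(G)$ (resp. $\gamma'_{\rm SMB}(G)$) is the smallest integer $k$ such that in the D-game (resp. S-game), under any strategy of Dominator, Staller can win having played at most $k$ vertices; the value is $\infty$ if Staller has no winning strategy. -}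

module Defs where

open import Data.Nat using (ℕ; zero; suc; _+_; _∸_; _^_; _≤_; _<_)
open import Data.Nat.DivMod using (_/_; _%_)
open import Data.Nat.Logarithm using (⌈log₂_⌉)
open import Data.Fin using (Fin; toℕ)
open import Data.List using (List; []; _∷_)
open import Data.List.Membership.Propositional using (_∈_; _∉_)
open import Data.Product using (Σ; ∃; _×_; _,_)
open import Data.Sum using (_⊎_)
open import Relation.Nullary using (¬_)
open import Relation.Binary.PropositionalEquality using (_≡_)

record Graph : Set₁ where
  field
    N   : ℕ
    Adj : Fin N → Fin N → Set

open Graph public

InN[_] : (G : Graph) → Fin (N G) → Fin (N G) → Set
InN[ G ] v w = (w ≡ v) ⊎ Adj G v w

StallerClaimed : (G : Graph) → List (Fin (N G)) → Set
StallerClaimed G S = ∃ λ v → ∀ w → InN[ G ] v w → w ∈ S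

Dominating : (G : Graph) → List (Fin (N G)) → Set
Dominating G D = ∀ v → ∃ λ w → InN[ G ] v w × w ∈ D

-- Maker–Breaker domination game.
-- D = vertices played by Dominator, S = vertices played by Staller.
-- StallerWinsS G m D S : Staller is to move and can force a win
--   playing at most m further vertices.
-- StallerWinsD G m D S : Dominator is to move (game not yet over) and
--   Staller can force a win playing at most m further vertices.

mutual
  data StallerWinsS (G : Graph) : ℕ → List (Fin (N G)) → List (Fin (N G)) → Set where
    smove : ∀ {m D S} (x : Fin (N G)) → x ∉ D → x ∉ S →
            (StallerClaimed G (x ∷ S) ⊎ StallerWinsD G m D (x ∷ S)) →
            StallerWinsS G (suc m) D S

  data StallerWinsD (G : Graph) : ℕ → List (Fin (N G)) → List (Fin (N G)) → Set where
    dmoves : ∀ {m D S} →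
             ¬ Dominating G D →
             (∃ λ y → y ∉ D × y ∉ S) →
             (∀ y → y ∉ D → y ∉ S → StallerWinsS G m (y ∷ D) S) →
             StallerWinsD G m D S

γSMB-infinite : Graph → Set
γSMB-infinite G = ∀ m → ¬ StallerWinsD G m [] []

γ'SMB-infinite : Graph → Set
γ'SMB-infinite G = ∀ m → ¬ StallerWinsS G m [] []

γ'SMB-is : Graph → ℕ → Set
γ'SMB-is G c = StallerWinsS G c [] [] × (∀ m → m < c → ¬ StallerWinsS G m [] [])

-- Tadpole graph T(n,k): vertex i < n is v_i, vertex n + (j - 1) is u_j
-- (1 ≤ j ≤ k). Edges: v_i v_{i+1 mod n}, u_j u_{j+1}, v_0 u_k.

data TadEdge (n k : ℕ) : ℕ → ℕ → Set where
  cyc   : ∀ {a} → suc a < n → TadEdge n k a (suc a)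
  cycWrap : TadEdge n k (n ∸ 1) 0
  path  : ∀ {a} → n ≤ a → suc a < n + k → TadEdge n k a (suc a)
  bridge : TadEdge n k 0 (n + k ∸ 1)

Tadpole : ℕ → ℕ → Graph
Tadpole n k = record
  { N = n + k
  ; Adj = λ a b → TadEdge n k (toℕ a) (toℕ b) ⊎ TadEdge n k (toℕ b) (toℕ a)
  }

-- σ(n) = (2^⌈log₂ n⌉ − n)/2 + 1   (an integer when n is even)
σ : ℕ → ℕ
σ n = ((2 ^ ⌈log₂ n ⌉) ∸ n) / 2 + 1

Even Odd : ℕ → Set
Even n = n % 2 ≡ 0
Odd n = n % 2 ≡ 1

{-# OPTIONS --safe #-}
module Submission where

open import Defs
open import Data.Nat using (ℕ; zero; suc; _+_; _∸_; _*_; _^_; _≤_; _<_; z≤n; s≤s; z<s; _≤?_; _<?_; ⌊_/2⌋; ⌈_/2⌉)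
open import Data.Nat.Properties hiding (_≟_)
open import Data.Nat.DivMod using (_mod_; _%_; _/_; m*n/n≡m; m<n⇒m%n≡m; [m+n]%n≡m%n; n%n≡0; m%n<n)
open import Data.Nat.Induction using (<-rec)
open import Data.Nat.Logarithm using (⌈log₂_⌉; ⌈log₂⌉-mono-≤; ⌈log₂2^n⌉≡n; ⌈log₂⌈n/2⌉⌉≡⌈log₂n⌉∸1)
open import Data.Nat.Tactic.RingSolver using (solve-∀)
open import Data.Fin using (Fin; toℕ)
open import Data.Fin.Properties using (_≟_; toℕ<n; toℕ-injective; toℕ-fromℕ<)
open import Data.List using (List; []; _∷_)
open import Data.List.Membership.Propositional using (_∈_; _∉_)
open import Data.List.Relation.Binary.Subset.Propositional using (_⊆_)
open import Data.List.Relation.Binary.Subset.Propositional.Properties using (∷⁺ʳ; xs⊆x∷xs)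
open import Data.List.Relation.Unary.Any using (here; there)
import Data.List.Membership.DecPropositional as DecMembership
open import Data.Product using (∃; ∃₂; _×_; _,_; proj₁; proj₂)
open import Data.Sum using (_⊎_; inj₁; inj₂; [_,_])
open import Data.Empty using (⊥; ⊥-elim)
open import Function using (_∘_; id)
open import Relation.Binary using (tri<; tri≈; tri>)
open import Relation.Binary.PropositionalEquality using (_≡_; _≢_; refl; sym; trans; cong; subst; module ≡-Reasoning)
open import Relation.Nullary using (¬_; yes; no; contradiction)

-- The tadpole is the path u₁ … u_k v₀ … v_{n-1} plus the chord v₀v_{n-1}: a lollipop with a stick and a cycle.
-- If n + k is even, this path has a perfect matching and Dominator answers in the partner; if n is odd and k is even,
-- the stick is matched and Dominator's first answer on the odd cycle leaves a matching of what still matters there.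
-- If n is even and k is odd, a Staller move at an odd position (counted from 0) leaves two smaller paths or lollipops
-- on which she can go on, and Dominator can destroy only one of them; all other moves let him match everything.
-- On a path with L vertices, L odd, this halving needs exactly m moves for 2^(m-1) < L + 1 ≤ 2^m.
-- On a lollipop with n = 2h and 2^p < n ≤ 2^(p+1), σ(n) = 2^p - h + 1, so the claimed bound is k + h + 2^p + 1 ≤ 2^m.
-- Cutting the stick halves k + h + 2^p; at v₀ the pieces have k and n - 1 vertices. At an even v_i the pieces are
-- the paths from u₁ through v₀ to v_{i-1} or, around the cycle, to v_{i+1}, the better i being close to h; there
-- Dominator has to answer next to v_i, since otherwise Staller plays v_{i-1}, threatening both v_{i-2} and v_{i+1}.

-- Parity of natural numbers

mutual
  data IsEven : ℕ → Set where
    zero : IsEven 0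
    suc  : ∀ {n} → IsOdd n → IsEven (suc n)

  data IsOdd : ℕ → Set where
    suc : ∀ {n} → IsEven n → IsOdd (suc n)

even-or-odd : ∀ n → IsEven n ⊎ IsOdd n
even-or-odd zero = inj₁ zero
even-or-odd (suc n) with even-or-odd n
... | inj₁ e = inj₂ (suc e)
... | inj₂ o = inj₁ (suc o)

¬even∧odd : ∀ {n} → IsEven n → ¬ IsOdd n
¬even∧odd (suc o) (suc e) = ¬even∧odd e o

mutual
  even+even : ∀ {m n} → IsEven m → IsEven n → IsEven (m + n)
  even+even zero    f = f
  even+even (suc o) f = suc (odd+even o f)

  odd+even : ∀ {m n} → IsOdd m → IsEven n → IsOdd (m + n)
  odd+even (suc e) f = suc (even+even e f)

mutual
  even+odd : ∀ {m n} → IsEven m → IsOdd n → IsOdd (m + n)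
  even+odd zero    f = f
  even+odd (suc o) f = suc (odd+odd o f)

  odd+odd : ∀ {m n} → IsOdd m → IsOdd n → IsEven (m + n)
  odd+odd (suc e) f = suc (even+odd e f)

even+⁻odd : ∀ {m n} → IsEven m → IsOdd (m + n) → IsOdd n
even+⁻odd {n = n} e o with even-or-odd n
... | inj₁ f = contradiction o (¬even∧odd (even+even e f))
... | inj₂ p = p

odd+⁻even : ∀ {m n} → IsOdd m → IsEven (m + n) → IsOdd n
odd+⁻even {n = n} o e with even-or-odd n
... | inj₁ f = contradiction (odd+even o f) (¬even∧odd e)
... | inj₂ p = p

odd⇒>0 : ∀ {n} → IsOdd n → 0 < n
odd⇒>0 (suc _) = s≤s z≤n

double-even : ∀ h → IsEven (h + h)
double-even zero    = zero
double-even (suc h) = suc (subst IsOdd (sym (+-suc h h)) (suc (double-even h)))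

double-pred-odd : ∀ {n} h → suc n ≡ h + h → IsOdd n
double-pred-odd h eq with suc o ← subst IsEven (sym eq) (double-even h) = o

-- Needed for reversing the cycle: position `suc (c + i)` goes to `suc (c + i′)`, which must be odd
-- again before the path up to it can be used.
cycle-arcs-odd : ∀ {c i i′} → IsOdd c → IsOdd (suc (c + i)) → IsOdd (suc (i + i′)) → IsOdd i′
cycle-arcs-odd oc (suc e) (suc f) = odd+⁻even (odd+⁻even oc e) f

odd<odd⇒suc< : ∀ {m n} → IsOdd m → IsOdd n → m < n → suc m < n
odd<odd⇒suc< o p m<n = ≤∧≢⇒< m<n λ { refl → ¬even∧odd (suc o) p }

even⇒double : ∀ {n} → IsEven n → ∃ λ h → n ≡ h + h
even⇒double zero = 0 , refl
even⇒double (suc (suc e)) with even⇒double e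
... | h , refl = suc h , cong suc (sym (+-suc h h))

Even⇒IsEven : ∀ n → Even n → IsEven n
Even⇒IsEven zero          _ = zero
Even⇒IsEven (suc (suc n)) e = suc (suc (Even⇒IsEven n e))

Odd⇒IsOdd : ∀ n → Odd n → IsOdd n
Odd⇒IsOdd (suc zero)    _ = suc zero
Odd⇒IsOdd (suc (suc n)) o = suc (suc (Odd⇒IsOdd n o))

IsEven⇒Even : ∀ {n} → IsEven n → Even n
IsEven⇒Even zero          = refl
IsEven⇒Even (suc (suc e)) = IsEven⇒Even e

IsOdd⇒Odd : ∀ {n} → IsOdd n → Odd n
IsOdd⇒Odd (suc zero)    = refl
IsOdd⇒Odd (suc (suc o)) = IsOdd⇒Odd o

-- Pairing and splitting positions of a path

-- `T` holds the smaller ends of the pairs, so one predicate on positions describes a whole set of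
-- pairs of consecutive positions.
Link : (ℕ → Set) → ℕ → ℕ → Set
Link T s t = (T s × t ≡ suc s) ⊎ (T t × s ≡ suc t)

link-sym : ∀ {T s t} → Link T s t → Link T t s
link-sym = [ inj₂ , inj₁ ]

link-range : ∀ {T L s t} → (∀ {s} → T s → suc s < L) → Link T s t → s < L
link-range range (inj₁ (q , refl)) = <-trans (n<1+n _) (range q)
link-range range (inj₂ (q , refl)) = range q

link-irrefl : ∀ {T s t} → Link T s t → s ≢ t
link-irrefl (inj₁ (_ , refl)) ()
link-irrefl (inj₂ (_ , refl)) ()

link-unique : ∀ {T s t u} → (∀ {s} → T s → ¬ T (suc s)) → Link T s t → Link T s u → t ≡ u
link-unique apart (inj₁ (_ , refl)) (inj₁ (_ , refl)) = refl
link-unique apart (inj₁ (q , _)) (inj₂ (r , refl)) = contradiction q (apart r)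
link-unique apart (inj₂ (q , refl)) (inj₁ (r , _)) = contradiction r (apart q)
link-unique apart (inj₂ (_ , refl)) (inj₂ (_ , refl)) = refl

-- After Staller takes position j of a path with positions 0, …, L - 1, Dominator answers at i,
-- pairs s with s + 1 for all s in T and keeps the positions in K as the new core.
record Split (L j i : ℕ) (T K : ℕ → Set) : Set where
  field
    j<L     : j < L
    i<L     : i < L
    i≢j     : i ≢ j
    T-range : ∀ {s} → T s → suc s < L
    T-apart : ∀ {s} → T s → ¬ T (suc s)
    T-avoid : ∀ {s} → T s → s ≢ j × suc s ≢ j
    T-outK  : ∀ {s} → T s → ¬ K s × ¬ K (suc s)
    K-avoid : ¬ K j
    cover   : ∀ t → t < L → (t ≡ i ⊎ t ≡ suc i ⊎ suc t ≡ i) ⊎ ∃ (Link T t) ⊎ K t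

Before : ℕ → ℕ → Set
Before j s = IsEven s × suc s < j

After : ℕ → ℕ → ℕ → Set
After j L s = IsOdd s × j < s × suc s < L

before-apart : ∀ {j s} → Before j s → ¬ Before j (suc s)
before-apart (e , _) (suc o , _) = ¬even∧odd e o

-- The pairs start at 0, so only the last position before `j` can stay alone, and only if it is
-- even.
before-cover : ∀ {j} t → t < j → (IsEven t × suc t ≡ j) ⊎ ∃ (Link (Before j) t)
before-cover t t<j with even-or-odd t
before-cover (suc s) t<j | inj₂ (suc e) = inj₂ (s , inj₂ ((e , t<j) , refl))
before-cover t t<j | inj₁ e with m≤n⇒m<n∨m≡n t<j
... | inj₁ lt = inj₂ (suc t , inj₁ ((e , lt) , refl))
... | inj₂ eq = inj₁ (e , eq)

after-cover : ∀ {j L} t → IsOdd L → j < t → t < L → (IsEven t × t ≡ suc j) ⊎ ∃ (Link (After j L) t)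
after-cover t oL j<t t<L with even-or-odd t
... | inj₂ o = inj₂ (suc t , inj₁ ((o , j<t , odd<odd⇒suc< o oL t<L) , refl))
after-cover (suc s) oL (s≤s j≤s) t<L | inj₁ (suc o) with m≤n⇒m<n∨m≡n j≤s
... | inj₁ lt = inj₂ (s , inj₂ ((o , lt , t<L) , refl))
... | inj₂ refl = inj₁ (suc o , refl)

-- The answer `suc j` dominates `j` and itself. The pairs start again at the odd position `j + 2`
-- and exhaust the rest because `L` is odd.
split-left : ∀ {L j} → IsOdd L → IsOdd j → j < L → Split L j (suc j) (After j L) (_< j)
split-left {L} {j} oL oj j<L = record
  { j<L = j<L
  ; i<L = odd<odd⇒suc< oj oL j<L
  ; i≢j = λ ()
  ; T-range = proj₂ ∘ proj₂
  ; T-apart = λ { (o , _) (suc e , _) → ¬even∧odd e o }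
  ; T-avoid = λ (_ , lt , _) → (λ { refl → <-irrefl refl lt }) , λ { refl → <⇒≱ lt (n≤1+n _) }
  ; T-outK = λ (_ , lt , _) → <-asym lt , <-asym (m<n⇒m<1+n lt)
  ; K-avoid = <-irrefl refl
  ; cover = cov
  }
  where
  cov : ∀ t → t < L → (t ≡ suc j ⊎ t ≡ suc (suc j) ⊎ suc t ≡ suc j) ⊎ ∃ (Link (After j L) t) ⊎ t < j
  cov t t<L with <-cmp t j
  ... | tri< lt _ _ = inj₂ (inj₂ lt)
  ... | tri≈ _ refl _ = inj₁ (inj₂ (inj₂ refl))
  ... | tri> _ _ gt with after-cover t oL gt t<L
  ...   | inj₁ (_ , eq) = inj₁ (inj₁ eq)
  ...   | inj₂ l = inj₂ (inj₁ l)

-- Pairing from 0 leaves alone only the even position just before the cut. The answer is given there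
-- and also dominates the cut position.
split-right : ∀ {L j} → IsOdd (suc j) → suc j < L → Split L (suc j) j (Before (suc j)) (suc j <_)
split-right {L} {j} oj j<L = record
  { j<L = j<L
  ; i<L = <-trans (n<1+n j) j<L
  ; i≢j = λ ()
  ; T-range = λ (_ , lt) → <-trans lt j<L
  ; T-apart = before-apart
  ; T-avoid = λ (_ , lt) → (λ { refl → <⇒≱ lt (n≤1+n _) }) , λ { refl → <-irrefl refl lt }
  ; T-outK = λ (_ , lt) → (λ gt → <-asym gt (<-trans (n<1+n _) lt)) , <-asym lt
  ; K-avoid = <-irrefl refl
  ; cover = cov
  }
  where
  cov : ∀ t → t < L → (t ≡ j ⊎ t ≡ suc j ⊎ suc t ≡ j) ⊎ ∃ (Link (Before (suc j)) t) ⊎ suc j < t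
  cov t t<L with <-cmp t (suc j)
  ... | tri> _ _ gt = inj₂ (inj₂ gt)
  ... | tri≈ _ eq _ = inj₁ (inj₂ (inj₁ eq))
  ... | tri< lt _ _ with before-cover t lt
  ...   | inj₁ (_ , refl) = inj₁ (inj₁ refl)
  ...   | inj₂ l = inj₂ (inj₁ l)

path-neighbour : ∀ {L} j → 2 < L → j < L → ∃ λ i → i < L × i ≢ j × (j ≡ suc i ⊎ suc j ≡ i)
path-neighbour zero    2<L j<L = 1 , <-trans (n<1+n 1) 2<L , (λ ()) , inj₂ refl
path-neighbour (suc i) 2<L j<L = i , <-trans (n<1+n i) j<L , (λ ()) , inj₁ refl

-- An even `j` has an even number of positions on each side. All of them are paired, so the answer
-- only has to dominate `j`; it may itself lie in a pair, which does no harm.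
split-none : ∀ {L j} → IsOdd L → 2 < L → IsEven j → j < L →
             ∃ λ i → Split L j i (λ s → Before j s ⊎ After j L s) (λ _ → ⊥)
split-none {L} {j} oL 2<L ej j<L = proj₁ answer , record
  { j<L = j<L
  ; i<L = proj₁ (proj₂ answer)
  ; i≢j = proj₁ (proj₂ (proj₂ answer))
  ; T-range = [ (λ (_ , lt) → <-trans lt j<L) , (λ (_ , _ , lt) → lt) ]
  ; T-apart = apart
  ; T-avoid = [ (λ (_ , lt) → (λ { refl → <⇒≱ lt (n≤1+n _) }) , λ { refl → <-irrefl refl lt })
              , (λ (_ , lt , _) → (λ { refl → <-irrefl refl lt }) , λ { refl → <⇒≱ lt (n≤1+n _) }) ]
  ; T-outK = λ _ → id , id
  ; K-avoid = id
  ; cover = cov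
  }
  where
  T : ℕ → Set
  T s = Before j s ⊎ After j L s
  apart : ∀ {s} → T s → ¬ T (suc s)
  apart (inj₁ (e , _))      (inj₁ (suc o , _)) = ¬even∧odd e o
  apart (inj₁ (_ , lt))     (inj₂ (_ , gt , _)) = <-asym lt gt
  apart (inj₂ (_ , gt , _)) (inj₁ (_ , lt)) = <-asym gt (<-trans (n<1+n _) (<-trans (n<1+n _) lt))
  apart (inj₂ (o , _))      (inj₂ (suc e , _)) = ¬even∧odd e o
  answer = path-neighbour j 2<L j<L
  cov : ∀ t → t < L → (t ≡ proj₁ answer ⊎ t ≡ suc (proj₁ answer) ⊎ suc t ≡ proj₁ answer) ⊎ ∃ (Link T t) ⊎ ⊥
  cov t t<L with <-cmp t j
  ... | tri≈ _ refl _ = inj₁ (inj₂ (proj₂ (proj₂ (proj₂ answer))))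
  ... | tri< lt _ _ with before-cover t lt
  ...   | inj₁ (e , refl) = contradiction ej (λ { (suc o) → ¬even∧odd e o })
  ...   | inj₂ (s , inj₁ (p , q)) = inj₂ (inj₁ (s , inj₁ (inj₁ p , q)))
  ...   | inj₂ (s , inj₂ (p , q)) = inj₂ (inj₁ (s , inj₂ (inj₁ p , q)))
  cov t t<L | tri> _ _ gt with after-cover t oL gt t<L
  ...   | inj₁ (suc o , refl) = contradiction o (¬even∧odd ej)
  ...   | inj₂ (s , inj₁ (p , q)) = inj₂ (inj₁ (s , inj₁ (inj₂ p , q)))
  ...   | inj₂ (s , inj₂ (p , q)) = inj₂ (inj₁ (s , inj₂ (inj₂ p , q)))


-- Linear arithmetic

-- Certificate for linear contradictions: the hypotheses are added, with multiplicities, to one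
-- inequality `a ≤ b`, and the ring solver shows that its left side is the larger one.
sum-absurd : ∀ {a b} e → a ≤ b → a ≢ suc (b + e)
sum-absurd {a} {b} e a≤b eq = <⇒≱ (s≤s (m≤m+n b e)) (subst (_≤ b) eq a≤b)

infixr 6 _+≤_
_+≤_ : ∀ {a b c d} → a ≤ b → c ≤ d → a + c ≤ b + d
_+≤_ = +-mono-≤

2^suc : ∀ m → 2 ^ suc m ≡ 2 ^ m + 2 ^ m
2^suc m = cong (2 ^ m +_) (+-identityʳ (2 ^ m))

-- Distinct powers of two differ by a factor of at least two. This gap decides all comparisons
-- between `2 ^ m` and `2 ^ p` in the bounds for lollipops.
2^<⇒double : ∀ p m → 2 ^ p < 2 ^ m → 2 ^ p + 2 ^ p ≤ 2 ^ m
2^<⇒double p m lt with p <? m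
... | yes p<m = subst (_≤ 2 ^ m) (2^suc p) (^-monoʳ-≤ 2 p<m)
... | no  p≮m = contradiction (^-monoʳ-≤ 2 (≮⇒≥ p≮m)) (<⇒≱ lt)

path-split-bound : ∀ {M j r} → M + M ≤ suc j + r → ¬ M ≤ j → M ≤ r
path-split-bound {M} {j} {r} le ¬le = +-cancelˡ-≤ M _ _ (≤-trans le (+-monoˡ-≤ r (≰⇒> ¬le)))

-- For a cut at the junction, with `M = 2 ^ m` and `q = 2 ^ p`. If both pieces had fewer than `M`
-- vertices, then `2h ≤ M`, so `q < M` and even `2q ≤ M`; hence `2c + 2h + 2q < 4M`, against the
-- bound.
junction-bound : ∀ {p m c h n} → suc n ≡ h + h → 2 ^ p < h + h → 2 ^ m + 2 ^ m ≤ c + h + 2 ^ p →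
                 ¬ 2 ^ m ≤ c → 2 ^ m ≤ n
junction-bound {p} {m} {c} {h} {n} eq q<2h le ¬le with 2 ^ m ≤? n
... | yes M≤n = M≤n
... | no  M≰n = ⊥-elim (sum-absurd 1
        (le +≤ le +≤ ≰⇒> ¬le +≤ ≰⇒> ¬le +≤ 2h≤M +≤ 2^<⇒double p m (<-≤-trans q<2h 2h≤M))
        (arith (2 ^ m) c h (2 ^ p)))
  where
  2h≤M : h + h ≤ 2 ^ m
  2h≤M = subst (_≤ 2 ^ m) eq (≰⇒> M≰n)
  arith : ∀ M c h q → (M + M) + ((M + M) + (suc c + (suc c + ((h + h) + (q + q))))) ≡
                      suc (((c + h + q) + ((c + h + q) + (M + (M + (M + M))))) + 1)
  arith = solve-∀

-- For a cut on the cycle, with `M = 2 ^ m` and `q = 2 ^ p`. If both paths had fewer than `M`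
-- vertices, then `c + h < M`, so the bound forces `q > M` and thus `q ≥ 2M`; but `q < 2h < 2M`.
cycle-bound : ∀ {p m c h i i′} → suc (suc (i + i′)) ≡ h + h → 2 ^ p < h + h →
              2 ^ m + 2 ^ m ≤ c + h + 2 ^ p →
              ¬ 2 ^ m ≤ suc (c + i) → 2 ^ m ≤ suc (c + i′)
cycle-bound {p} {m} {c} {h} {i} {i′} eq q<2h le ¬le with 2 ^ m ≤? suc (c + i′)
... | yes M≤ = M≤
... | no  M≰ = ⊥-elim (sum-absurd (c + c + 2) (2^<⇒double m p M<q +≤ q<2h +≤ 2c+2h<2M) (arith₂ (2 ^ m) c h (2 ^ p)))
  where
  arith₀ : ∀ c i i′ → suc (suc (c + i)) + suc (suc (c + i′)) ≡ (c + c) + suc (suc (i + i′)) + 2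
  arith₀ = solve-∀
  arith₁ : ∀ M c h q → (M + M) + ((M + M) + (((c + c) + (h + h) + 2) + (q + q))) ≡
                       suc ((c + h + q) + ((c + h + q) + ((M + M) + (M + M))) + 1)
  arith₁ = solve-∀
  arith₂ : ∀ M c h q → (M + M) + (suc q + ((c + c) + (h + h) + 2)) ≡ suc (q + ((h + h) + (M + M)) + (c + c + 2))
  arith₂ = solve-∀
  2c+2h<2M : (c + c) + (h + h) + 2 ≤ 2 ^ m + 2 ^ m
  2c+2h<2M = subst (λ x → (c + c) + x + 2 ≤ 2 ^ m + 2 ^ m) eq
               (subst (_≤ 2 ^ m + 2 ^ m) (arith₀ c i i′) (≰⇒> ¬le +≤ ≰⇒> M≰))
  M<q : 2 ^ m < 2 ^ p
  M<q with 2 ^ m <? 2 ^ p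
  ... | yes lt = lt
  ... | no ¬lt = ⊥-elim (sum-absurd 1 (le +≤ le +≤ 2c+2h<2M +≤ ≮⇒≥ ¬lt +≤ ≮⇒≥ ¬lt) (arith₁ (2 ^ m) c h (2 ^ p)))

-- Where Staller cuts paths and cycles

2^suc-pred-odd : ∀ m → ∃ λ j → IsOdd j × 2 ^ suc m ≡ suc j
2^suc-pred-odd m with subst IsEven (sym (2^suc m)) (double-even (2 ^ m)) | m^n>0 2 (suc m)
... | e | lt with 2 ^ suc m | e | lt
...   | suc j | suc o | _ = j , o , refl

path-cut : ∀ m {L} → IsOdd L → 1 < L → L < 2 ^ suc m →
           ∃₂ λ j r → IsOdd j × L ≡ suc j + r × j < 2 ^ m × r < 2 ^ m
path-cut m {L} oL 1<L L<2M with 2 ^ m <? L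
... | no M≮L with L | oL | 1<L
-- A path with at most `2 ^ m` vertices may be cut at any odd position; 1 is the first.
...   | suc (suc (suc r)) | _ | _ = 1 , suc r , suc zero , refl , ≤-trans (s≤s (s≤s z≤n)) (≮⇒≥ M≮L) , ≤-trans (n≤1+n _) (≮⇒≥ M≮L)
...   | suc zero | _ | s≤s ()
...   | suc (suc zero) | suc (suc ()) | _
path-cut zero oL 1<L L<2M | yes _ = contradiction L<2M (≤⇒≯ 1<L)
path-cut (suc m) {L} oL 1<L L<2M | yes M<L with 2^suc-pred-odd m | m≤n⇒∃[o]m+o≡n (<⇒≤ M<L)
-- A longer path is cut at `2 ^ suc m - 1`, the largest admissible left piece; the right piece is
-- the excess over `2 ^ suc m`.
... | j , oj , eq | r , refl = j , r , oj , cong (_+ r) eq , ≤-reflexive (sym eq) ,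
        +-cancelˡ-< (2 ^ suc m) _ _ (subst (2 ^ suc m + r <_) (2^suc (suc m)) L<2M)

2^-not-odd : ∀ m → 0 < m → ¬ IsOdd (2 ^ m)
2^-not-odd (suc m) _ o with 2^suc-pred-odd m
... | _ , o′ , eq = ¬even∧odd (suc o′) (subst IsOdd eq o)

-- Since `c ≥ 1`, the last hypothesis gives `h + 2 ≤ 2 ^ m`, which for `m ≤ 2` is incompatible with
-- `2 ^ m < h + h`; from `m = 3` on the latter yields `4 < h`. This secures the room and the moves
-- for the double threat.
half-cycle-large : ∀ {m c h} → IsOdd c → 2 ^ m < h + h → c + suc h ≤ 2 ^ m → 4 < h × 2 < m
half-cycle-large {m} {suc c} {h} _ M<2h le = large m M<2h le
  where
  small : ∀ x → h ≤ x → h + h ≤ x + x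
  small x le = +-mono-≤ le le
  h+2≤ : ∀ {x} → suc c + suc h ≤ suc (suc x) → h ≤ x
  h+2≤ (s≤s q) = ≤-pred (≤-trans (m≤n+m (suc h) c) q)
  large : ∀ m → 2 ^ m < h + h → suc c + suc h ≤ 2 ^ m → 4 < h × 2 < m
  large 0 _ (s≤s q) = contradiction (≤-trans (m≤n+m (suc h) c) q) λ ()
  large 1 lt q = contradiction (<-≤-trans lt (small 0 (h+2≤ q))) λ ()
  large 2 lt q = contradiction (<-≤-trans lt (small 2 (h+2≤ q))) (<-irrefl refl)
  large (suc (suc (suc m))) lt q with 4 <? h
  ... | yes p = p , s≤s (s≤s (s≤s z≤n))
  ... | no ¬p = contradiction (≤-trans lt (small 4 (≮⇒≥ ¬p))) (≤⇒≯ (^-monoʳ-≤ 2 {3} {suc (suc (suc m))} (s≤s (s≤s (s≤s z≤n)))))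

-- The two arcs should be nearly equal, but with `c` odd an odd cut position needs an odd arc. If
-- `h - 1` is odd, both arcs have length `h - 1`; otherwise the lengths are `h - 2` and `h`.
cycle-cut : ∀ {m c h n} → suc n ≡ h + h → IsOdd c → 2 ^ m < h + h → c + suc h ≤ 2 ^ m →
            ∃₂ λ i i′ → n ≡ suc (suc (suc i) + suc i′) × 2 < m × IsOdd (suc (c + suc (suc i))) ×
                        suc (c + suc (suc i)) < 2 ^ m × suc (c + suc i′) < 2 ^ m
cycle-cut {m} {c} {h} {n} eq oc M<2h le with half-cycle-large {m} {c} {h} oc M<2h le
... | s≤s (s≤s (s≤s (s≤s {n = g} _))) , 2<m with even-or-odd g | le | eq
...   | inj₁ e | le | eq = suc g , suc (suc g) , suc-injective (trans eq (arith g)) , 2<m ,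
          suc (odd+odd oc (suc (suc (suc e)))) , le′ , le′
  where
  arith : ∀ g → (4 + g) + (4 + g) ≡ suc (suc ((3 + g) + (3 + g)))
  arith = solve-∀
  le′ : suc (c + (3 + g)) < 2 ^ m
  le′ = subst (_≤ 2 ^ m) (trans (+-suc c (4 + g)) (cong suc (+-suc c (3 + g)))) le
...   | inj₂ o | le | eq = g , 3 + g , suc-injective (trans eq (arith g)) , 2<m ,
          suc (odd+odd oc (suc (suc o))) , ≤-trans (s≤s (s≤s (+-monoʳ-≤ c (≤-trans (n≤1+n _) (n≤1+n _))))) le″ ,
          le″
  where
  arith : ∀ g → (4 + g) + (4 + g) ≡ suc (suc ((2 + g) + (4 + g)))
  arith = solve-∀
  le″ : suc (suc (c + (4 + g))) ≤ 2 ^ m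
  -- The longer path has `c + h + 1` vertices, an odd number, so it cannot equal the even `2 ^ m`.
  -- Parity supplies the strict inequality.
  le″ = ≤∧≢⇒< (≤-trans (≤-reflexive (sym (+-suc c (4 + g)))) le)
    λ eq → 2^-not-odd m (<-trans z<s 2<m) (subst IsOdd eq (suc (odd+odd oc (suc (suc (suc (suc o)))))))

-- From `2 ^ p < 2 ^ m` the factor-two gap would give `h + h ≤ 2 ^ m`. Hence `2 ^ m ≤ 2 ^ p`, and
-- subtracting `2 ^ p` from the bound leaves the inequality that a cut on the cycle requires.
junction-or-cycle : ∀ p m {c h} → h + h ≤ 2 ^ p + 2 ^ p → c + h + suc (2 ^ p) ≤ 2 ^ m + 2 ^ m →
                    2 ^ m < h + h → c + suc h ≤ 2 ^ m
junction-or-cycle p m {c} {h} 2h≤2q bound M<2h with 2 ^ p <? 2 ^ m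
... | yes q<M = contradiction (<-≤-trans M<2h (≤-trans 2h≤2q (2^<⇒double p m q<M))) (<-irrefl refl)
... | no  q≮M = +-cancelʳ-≤ (2 ^ p) _ _
                  (≤-trans (≤-reflexive (arith c h (2 ^ p))) (≤-trans bound (+-monoʳ-≤ (2 ^ m) (≮⇒≥ q≮M))))
  where
  arith : ∀ c h q → c + suc h + q ≡ c + h + suc q
  arith = solve-∀

-- Excludes fewer than two moves at the base of Staller's induction on lollipops.
lollipop-size : ∀ p {c h} → IsOdd c → 2 ^ p < h + h → 4 ≤ c + h + suc (2 ^ p)
lollipop-size p {h = zero}  _  ()
lollipop-size p {h = suc _} oc _ = +-mono-≤ (+-mono-≤ (odd⇒>0 oc) (s≤s z≤n)) (s≤s (m^n>0 2 p))

-- The rounded logarithm and `σ`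

≤2^⇒⌈log₂⌉≤ : ∀ {x} m → x ≤ 2 ^ m → ⌈log₂ x ⌉ ≤ m
≤2^⇒⌈log₂⌉≤ m le = subst (_ ≤_) (⌈log₂2^n⌉≡n m) (⌈log₂⌉-mono-≤ le)

-- Strong induction along the halving law of the logarithm: doubling the bound for `⌈ x /2⌉` gives
-- the bound for `x`.
≤2^⌈log₂⌉ : ∀ x → x ≤ 2 ^ ⌈log₂ x ⌉
≤2^⌈log₂⌉ = <-rec _ step
  where
  step : ∀ x → (∀ {y} → y < x → y ≤ 2 ^ ⌈log₂ y ⌉) → x ≤ 2 ^ ⌈log₂ x ⌉
  step 0 _ = z≤n
  step 1 _ = s≤s z≤n
  step x@(suc (suc x′)) later = from-half ⌈log₂ x ⌉ (⌈log₂⌉-mono-≤ {2} {x} (s≤s (s≤s z≤n)))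
    (subst (λ e → ⌈ x /2⌉ ≤ 2 ^ e) (⌈log₂⌈n/2⌉⌉≡⌈log₂n⌉∸1 x) (later (⌈n/2⌉<n x′)))
    where
    from-half : ∀ e → 1 ≤ e → ⌈ x /2⌉ ≤ 2 ^ (e ∸ 1) → x ≤ 2 ^ e
    from-half (suc e) _ half = subst (x ≤_) (sym (2^suc e))
      (≤-trans (≤-reflexive (sym (⌊n/2⌋+⌈n/2⌉≡n x))) (+-mono-≤ (≤-trans (⌊n/2⌋≤⌈n/2⌉ x) half) half))

double-cancel-≤ : ∀ {a b} → a + a ≤ b + b → a ≤ b
double-cancel-≤ {a} {b} le with a ≤? b
... | yes p = p
... | no ¬p = contradiction le (<⇒≱ (+-mono-< (≰⇒> ¬p) (≰⇒> ¬p)))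

exponent>0 : ∀ e → 1 < 2 ^ e → ∃ λ p → e ≡ suc p
exponent>0 zero    (s≤s ())
exponent>0 (suc p) _ = p , refl

-- Replaces the logarithm inside `σ` by a power `2 ^ p` that can be compared with path lengths. The
-- division by 2 in `σ` is exact because `2 ^ suc p` and `h + h` are both even.
half-log : ∀ h → 3 ≤ h + h → ∃ λ p → 2 ^ p < h + h × h + h ≤ 2 ^ p + 2 ^ p × σ (h + h) + h ≡ suc (2 ^ p)
half-log h 3≤n with exponent>0 ⌈log₂ h + h ⌉ (<-≤-trans (s≤s (s≤s z≤n)) (≤-trans 3≤n (≤2^⌈log₂⌉ (h + h))))
... | p , eq = p , ≰⇒> (λ le → <-irrefl refl (subst (_≤ p) eq (≤2^⇒⌈log₂⌉≤ p le))) , n≤2q , σ-value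
  where
  n≤2q : h + h ≤ 2 ^ p + 2 ^ p
  n≤2q = subst (h + h ≤_) (2^suc p) (subst (λ e → h + h ≤ 2 ^ e) eq (≤2^⌈log₂⌉ (h + h)))
  excess : ∀ {x} q → x ≡ q + q → h ≤ q → (x ∸ (h + h)) / 2 + 1 + h ≡ suc q
  excess q refl h≤q with m≤n⇒∃[o]m+o≡n h≤q
  ... | d , refl = begin
      ((h + d + (h + d)) ∸ (h + h)) / 2 + 1 + h
        ≡⟨ cong (λ x → (x ∸ (h + h)) / 2 + 1 + h) (arith h d) ⟩
      ((h + h + d * 2) ∸ (h + h)) / 2 + 1 + h
        ≡⟨ cong (λ x → x / 2 + 1 + h) (m+n∸m≡n (h + h) (d * 2)) ⟩
      d * 2 / 2 + 1 + h
        ≡⟨ cong (λ x → x + 1 + h) (m*n/n≡m d 2) ⟩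
      d + 1 + h
        ≡⟨ arith′ h d ⟩
      suc (h + d) ∎
    where
    open ≡-Reasoning
    arith : ∀ h d → h + d + (h + d) ≡ h + h + d * 2
    arith = solve-∀
    arith′ : ∀ h d → d + 1 + h ≡ suc (h + d)
    arith′ = solve-∀
  σ-value : (2 ^ ⌈log₂ (h + h) ⌉ ∸ (h + h)) / 2 + 1 + h ≡ suc (2 ^ p)
  σ-value = excess (2 ^ p) (trans (cong (2 ^_) eq) (2^suc p)) (double-cancel-≤ n≤2q)

-- Reversing the cycle of a lollipop: positions 0, …, c form the stick, c, …, c + n′ the cycle

reflect : ℕ → ℕ → ℕ → ℕ
reflect c n′ t with t ≤? c
... | yes _ = t
-- This constant exchanges the two ends `c + 1` and `c + n′` of the cycle part.
... | no  _ = suc (c + n′ + c) ∸ t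

reflect-stick : ∀ {c n′ t} → t ≤ c → reflect c n′ t ≡ t
reflect-stick {c} {n′} {t} t≤c with t ≤? c
... | yes _ = refl
... | no ¬p = contradiction t≤c ¬p

reflect-cycle : ∀ c {n′} i i′ → n′ ≡ suc (i + i′) → reflect c n′ (suc (c + i)) ≡ suc (c + i′)
reflect-cycle c i i′ refl with suc (c + i) ≤? c
... | yes p = contradiction (m≤m+n c i) (<⇒≱ p)
... | no _ = trans (cong (_∸ (c + i)) (arith c i i′)) (m+n∸m≡n (c + i) _)
  where
  arith : ∀ c i i′ → c + suc (i + i′) + c ≡ (c + i) + suc (c + i′)
  arith = solve-∀

-- Off the stick, a position carries the numbers `i` and `i′` of vertices between it and the
-- junction in the two directions; reversal exchanges them.
data LollipopPosition (c n′ : ℕ) : ℕ → Set where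
  stick : ∀ {t} → t ≤ c → LollipopPosition c n′ t
  cycle : ∀ i i′ → n′ ≡ suc (i + i′) → LollipopPosition c n′ (suc (c + i))

lollipop-position : ∀ c n′ t → t < suc (c + n′) → LollipopPosition c n′ t
lollipop-position c n′ t t<L with t ≤? c
... | yes p = stick p
... | no ¬p with m≤n⇒∃[o]m+o≡n (≰⇒> ¬p)
...   | i , refl with m≤n⇒∃[o]m+o≡n (+-cancelˡ-< c i n′ (≤-pred t<L))
...     | i′ , refl = cycle i i′ refl

reflect-involutive : ∀ {c n′ t} → t < suc (c + n′) → reflect c n′ (reflect c n′ t) ≡ t
reflect-involutive {c} {n′} {t} t<L with lollipop-position c n′ t t<L
... | stick t≤c = trans (cong (reflect c n′) (reflect-stick t≤c)) (reflect-stick t≤c)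
... | cycle i i′ eq = trans (cong (reflect c n′) (reflect-cycle c i i′ eq))
                            (reflect-cycle c i′ i (trans eq (cong suc (+-comm i i′))))

reflect-< : ∀ {c n′ t} → t < suc (c + n′) → reflect c n′ t < suc (c + n′)
reflect-< {c} {n′} {t} t<L with lollipop-position c n′ t t<L
... | stick t≤c = subst (_< suc (c + n′)) (sym (reflect-stick t≤c)) t<L
... | cycle i i′ refl = subst (_< suc (c + n′)) (sym (reflect-cycle c i i′ refl))
                          (s≤s (+-monoʳ-< c (s≤s (m≤n+m i′ i))))

reflect-injective : ∀ {c n′ s t} → s < suc (c + n′) → t < suc (c + n′) →
                    reflect c n′ s ≡ reflect c n′ t → s ≡ t
reflect-injective {c} {n′} s<L t<L eq =
  trans (sym (reflect-involutive s<L)) (trans (cong (reflect c n′) eq) (reflect-involutive t<L))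

-- The game on an arbitrary graph: monotonicity and pairing strategies

module DominationGame (G : Graph) where

  open DecMembership (_≟_ {N G}) using (_∈?_)

  V : Set
  V = Fin (N G)

  infix 4 _∈N_
  _∈N_ : V → V → Set
  w ∈N v = InN[ G ] v w

  mutual
    -- Additional vertices never hurt Dominator, so Staller's strategy against `D′` also works
    -- against the smaller `D`.
    extra-moves-S : ∀ {m D D′ S} → D ⊆ D′ → StallerWinsS G m D′ S → StallerWinsS G m D S
    extra-moves-S sub (smove x x∉D x∉S (inj₁ c)) = smove x (x∉D ∘ sub) x∉S (inj₁ c)
    extra-moves-S sub (smove x x∉D x∉S (inj₂ d)) = smove x (x∉D ∘ sub) x∉S (inj₂ (extra-moves-D sub d))

    extra-moves-D : ∀ {m D D′ S} → D ⊆ D′ → StallerWinsD G m D′ S → StallerWinsD G m D S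
    extra-moves-D {m} {D} {D′} {S} sub (dmoves ¬dom (y , y∉D′ , y∉S) h) =
      dmoves (λ dom → ¬dom λ v → let (w , w∈N , w∈D) = dom v in w , w∈N , sub w∈D)
             (y , y∉D′ ∘ sub , y∉S) next
      where
      next : ∀ z → z ∉ D → z ∉ S → StallerWinsS G m (z ∷ D) S
      next z _ z∉S with z ∈? D′
      -- Here `z` brings nothing new to `D′`, so Staller follows her strategy as if Dominator had
      -- played the spare vertex `y`.
      ... | yes z∈D′ = extra-moves-S (λ { (here refl) → there z∈D′ ; (there p) → there (sub p) }) (h y y∉D′ y∉S)
      ... | no  z∉D′ = extra-moves-S (∷⁺ʳ z sub) (h z z∉D′ z∉S)

  pass : ∀ {m D S} → ¬ StallerWinsS G m D S → ¬ StallerWinsD G m D S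
  pass ¬win (dmoves _ (y , y∉D , y∉S) h) = ¬win (extra-moves-S (xs⊆x∷xs _ y) (h y y∉D y∉S))

  -- The answer `y` may already belong to Dominator, in which case he passes. Pairing strategies
  -- therefore never have to check whether a partner is still unplayed.
  reply : ∀ {m D S} y → y ∉ S → ¬ StallerWinsS G m (y ∷ D) S → ¬ StallerWinsD G m D S
  reply {D = D} y y∉S ¬win d@(dmoves _ _ h) with y ∈? D
  ... | yes y∈D = pass (λ win → ¬win (extra-moves-S (λ { (here refl) → y∈D ; (there p) → p }) win)) d
  ... | no  y∉D = ¬win (h y y∉D y∉S)

  -- Dominator's bookkeeping: every vertex is dominated, or has a pair of P inside its closed
  -- neighbourhood, or belongs to the core C, where the fight is still open.
  record Guard (D S : List V) (C : V → Set) (P : V → V → Set) : Set where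
    field
      disjoint : ∀ {v} → v ∈ D → v ∉ S
      P-sym    : ∀ {a b} → P a b → P b a
      P-unique : ∀ {a b c} → P a b → P a c → b ≡ c
      P-irrefl : ∀ {a b} → P a b → a ≢ b
      P-free   : ∀ {a b} → P a b → a ∉ S
      P-outC   : ∀ {a b} → P a b → ¬ C a
      C-free   : ∀ {a} → C a → a ∉ S
      cover    : ∀ v → (∃ λ w → w ∈N v × w ∈ D) ⊎ (∃₂ λ a b → P a b × a ∈N v × b ∈N v) ⊎ C v

  open Guard

  guard-answer : ∀ {D S C P x b} → Guard D S C P → x ∉ D → ¬ C x → P x b →
                 Guard (b ∷ D) (x ∷ S) C (λ a c → P a c × a ≢ x × c ≢ x)
  guard-answer {D} {S} {C} {P} {x} {b} g x∉D ¬Cx Pxb = record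
    { disjoint = λ { (here refl) (here refl) → P-irrefl g Pxb refl
                   ; (here refl) (there p) → P-free g (P-sym g Pxb) p
                   ; (there p) (here refl) → x∉D p
                   ; (there p) (there q) → disjoint g p q }
    ; P-sym = λ (p , q , r) → P-sym g p , r , q
    ; P-unique = λ (p , _) (q , _) → P-unique g p q
    ; P-irrefl = P-irrefl g ∘ proj₁
    ; P-free = λ { (p , q , _) (here refl) → q refl ; (p , _) (there q) → P-free g p q }
    ; P-outC = P-outC g ∘ proj₁
    ; C-free = λ { c (here refl) → ¬Cx c ; c (there q) → C-free g c q }
    ; cover = cov
    }
    where
    cov : ∀ v → (∃ λ w → w ∈N v × w ∈ b ∷ D) ⊎ (∃₂ λ a c → (P a c × a ≢ x × c ≢ x) × a ∈N v × c ∈N v) ⊎ C v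
    cov v with cover g v
    ... | inj₁ (w , w∈N , w∈D) = inj₁ (w , w∈N , there w∈D)
    ... | inj₂ (inj₂ c) = inj₂ (inj₂ c)
    ... | inj₂ (inj₁ (a , c , Pac , a∈ , c∈)) with a ≟ x | c ≟ x
    ...   | yes refl | _ = inj₁ (c , c∈ , here (P-unique g Pac Pxb))
    ...   | no _ | yes refl = inj₁ (a , a∈ , here (P-unique g (P-sym g Pac) Pxb))
    ...   | no a≢x | no c≢x = inj₂ (inj₁ (a , c , (Pac , a≢x , c≢x) , a∈ , c∈))

  guard-pass : ∀ {D S C P x} → Guard D S C P → x ∉ D → ¬ C x → ¬ ∃ (P x) → Guard D (x ∷ S) C P
  guard-pass g x∉D ¬Cx ¬Px = record
    { disjoint = λ { p (here refl) → x∉D p ; p (there q) → disjoint g p q }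
    ; P-sym = P-sym g
    ; P-unique = P-unique g
    ; P-irrefl = P-irrefl g
    ; P-free = λ { p (here refl) → ¬Px (_ , p) ; p (there q) → P-free g p q }
    ; P-outC = P-outC g
    ; C-free = λ { c (here refl) → ¬Cx c ; c (there q) → C-free g c q }
    ; cover = cover g
    }

  -- Two core vertices in each closed neighbourhood: one Staller move cannot complete a
  -- neighbourhood of the core.
  Live : (V → Set) → Set
  Live C = ∀ v → C v → ∃₂ λ a b → a ≢ b × (C a × a ∈N v) × (C b × b ∈N v)

  survive-claim : ∀ {D S C P x} → Guard D S C P → Live C → x ∉ D → ¬ StallerClaimed G (x ∷ S)
  survive-claim {x = x} g live x∉D (v , all) with cover g v
  ... | inj₁ (w , w∈N , w∈D) with all w w∈N
  ...   | here refl = x∉D w∈D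
  ...   | there w∈S = disjoint g w∈D w∈S
  survive-claim g live x∉D (v , all) | inj₂ (inj₁ (a , b , Pab , a∈ , b∈)) with all a a∈ | all b b∈
  ... | here refl | here refl = P-irrefl g Pab refl
  ... | there p   | _ = P-free g Pab p
  ... | _         | there q = P-free g (P-sym g Pab) q
  survive-claim g live x∉D (v , all) | inj₂ (inj₂ c) with live v c
  ... | a , b , a≢b , (Ca , a∈) , (Cb , b∈) with all a a∈ | all b b∈
  ...   | here refl | here refl = a≢b refl
  ...   | there p   | _ = C-free g Ca p
  ...   | _         | there q = C-free g Cb q

  -- Cores and pairings are arbitrary predicates. The survival statements are negations, so case
  -- distinctions on them are still available.
  ¬¬-em : ∀ {A : Set} → ¬ ¬ (A ⊎ ¬ A)
  ¬¬-em f = f (inj₂ (f ∘ inj₁))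

  -- Outside the core Dominator answers by the pairing or passes, and the core stays the same. What
  -- remains to be supplied is a strategy against moves inside the core.
  survive-step : ∀ {m D S C P} → Guard D S C P → Live C →
    (∀ {D S P} → Guard D S C P → ¬ StallerWinsS G m D S) →
    (∀ x → C x → x ∉ D → ¬ StallerWinsD G m D (x ∷ S)) →
    ¬ StallerWinsS G (suc m) D S
  survive-step g live later onCore (smove x x∉D x∉S (inj₁ c)) = survive-claim g live x∉D c
  survive-step {C = C} {P} g live later onCore (smove x x∉D x∉S (inj₂ d)) = ¬¬-em λ where
    (inj₁ Cx)  → onCore x Cx x∉D d
    (inj₂ ¬Cx) → ¬¬-em {∃ (P x)} λ where
      (inj₁ (b , Pxb)) → reply b (λ { (here refl) → P-irrefl g Pxb refl ; (there q) → P-free g (P-sym g Pxb) q })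
                               (later (guard-answer g x∉D ¬Cx Pxb)) d
      (inj₂ ¬Px) → pass (later (guard-pass g x∉D ¬Cx ¬Px)) d

  survive-forever : ∀ m {D S P} → Guard D S (λ _ → ⊥) P → ¬ StallerWinsS G m D S
  survive-forever (suc m) g = survive-step g (λ _ ()) (survive-forever m) λ _ ()

  -- Dominator's strategy on paths

  Core : (ℕ → V) → ℕ → V → Set
  Core w L v = ∃ λ t → t < L × w t ≡ v

  -- Further edges between the vertices are allowed, so the path through a whole lollipop also
  -- qualifies.
  record IsPath (w : ℕ → V) (L : ℕ) : Set where
    field
      inj : ∀ {s t} → s < L → t < L → w s ≡ w t → s ≡ t
      adj : ∀ {t} → suc t < L → w (suc t) ∈N w t × w t ∈N w (suc t)

  open IsPath

  path-take : ∀ {w j L} → j ≤ L → IsPath w L → IsPath w j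
  path-take j≤L p = record
    { inj = λ s<j t<j → inj p (<-≤-trans s<j j≤L) (<-≤-trans t<j j≤L)
    ; adj = λ lt → adj p (<-≤-trans lt j≤L)
    }

  path-drop : ∀ {w r} a → IsPath w (a + r) → IsPath (w ∘ (a +_)) r
  path-drop {w} {r} a p = record
    { inj = λ s<r t<r eq → +-cancelˡ-≡ a _ _ (inj p (+-monoʳ-< a s<r) (+-monoʳ-< a t<r) eq)
    ; adj = λ {t} lt → subst (λ u → w u ∈N w (a + t) × w (a + t) ∈N w u) (sym (+-suc a t))
                         (adj p (subst (_< a + r) (+-suc a t) (+-monoʳ-< a lt)))
    }

  path-close : ∀ {w L t i} → IsPath w L → t < L → i < L → t ≡ i ⊎ t ≡ suc i ⊎ suc t ≡ i → w i ∈N w t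
  path-close p _   _   (inj₁ refl)        = inj₁ refl
  path-close p t<L _   (inj₂ (inj₁ refl)) = proj₂ (adj p t<L)
  path-close p _   i<L (inj₂ (inj₂ refl)) = proj₁ (adj p i<L)

  path-live : ∀ {w L} → IsPath w L → 1 < L → Live (Core w L)
  path-live p 1<L _ (zero , t<L , refl) =
    _ , _ , (λ eq → 0≢1+n (inj p t<L 1<L eq)) ,
    ((0 , t<L , refl) , inj₁ refl) , ((1 , 1<L , refl) , proj₁ (adj p 1<L))
  path-live p 1<L _ (suc t , t<L , refl) =
    _ , _ , (λ eq → 1+n≢n (inj p t<L (<-trans (n<1+n t) t<L) eq)) ,
    ((suc t , t<L , refl) , inj₁ refl) , ((t , <-trans (n<1+n t) t<L , refl) , proj₂ (adj p t<L))

  Matched : (ℕ → V) → (ℕ → Set) → V → V → Set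
  Matched w T a b = ∃₂ λ s t → Link T s t × w s ≡ a × w t ≡ b

  matched-sym : ∀ {w T a b} → Matched w T a b → Matched w T b a
  matched-sym (s , t , l , eq , eq′) = t , s , link-sym l , eq′ , eq

  matched-irrefl : ∀ {w L T a b} → IsPath w L → (∀ {s} → T s → suc s < L) → Matched w T a b → a ≢ b
  matched-irrefl p range (s , t , l , refl , refl) eq =
    link-irrefl l (inj p (link-range range l) (link-range range (link-sym l)) eq)

  matched-unique : ∀ {w L T a b c} → IsPath w L → (∀ {s} → T s → suc s < L) → (∀ {s} → T s → ¬ T (suc s)) →
                   Matched w T a b → Matched w T a c → b ≡ c
  matched-unique {w} p range apart (s , t , l , refl , refl) (s′ , t′ , l′ , eq , refl)
    with refl ← inj p (link-range range l′) (link-range range l) eq = cong w (link-unique apart l l′)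

  link-close : ∀ {w L T s t} → IsPath w L → (∀ {s} → T s → suc s < L) → Link T t s → w s ∈N w t
  link-close p range l = path-close p (link-range range l) (link-range range (link-sym l))
    (inj₂ ([ (λ q → inj₂ (sym (proj₂ q))) , (λ q → inj₁ (proj₂ q)) ] l))

  guard-initial : ∀ {w L D C T} → IsPath w L → (∀ {s} → T s → suc s < L) → (∀ {s} → T s → ¬ T (suc s)) →
                  (∀ {s t} → Link T s t → ¬ C (w s)) →
                  (∀ v → (∃ λ u → u ∈N v × u ∈ D) ⊎ (∃₂ λ t s → Link T t s × w t ≡ v) ⊎ C v) →
                  Guard D [] C (Matched w T)
  guard-initial {w} p range apart outC cov = record
    { disjoint = λ _ ()
    ; P-sym = matched-sym
    ; P-unique = matched-unique p range apart
    ; P-irrefl = matched-irrefl p range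
    ; P-free = λ _ ()
    ; P-outC = λ { (s , t , l , refl , _) → outC l }
    ; C-free = λ _ ()
    ; cover = λ v → [ inj₁ , [ (λ { (t , s , l , refl) → inj₂ (inj₁ (w t , w s , (t , s , l , refl , refl) , inj₁ refl , link-close p range l)) })
                             , inj₂ ∘ inj₂ ] ] (cov v)
    }

  -- The new pairs lie inside the old core while the old pairs avoid it, so the two families cannot
  -- clash.
  guard-split : ∀ {w L j i T K D S P} (C′ : V → Set) → IsPath w L → Split L j i T K →
                (∀ {v} → C′ v → ∃ λ t → t < L × K t × w t ≡ v) →
                (∀ {t} → t < L → K t → C′ (w t)) →
                w j ∉ D → Guard D S (Core w L) P →
                Guard (w i ∷ D) (w j ∷ S) C′ (λ a b → P a b ⊎ Matched w T a b)
  guard-split {w} {L} {j} {i} {T} {K} {D} {S} {P} C′ p sp C′⇒K K⇒C′ wj∉D g = record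
    { disjoint = λ { (here refl) (here eq) → i≢j (inj p i<L j<L eq)
                   ; (here refl) (there q) → C-free g (i , i<L , refl) q
                   ; (there d) (here refl) → wj∉D d
                   ; (there d) (there q) → disjoint g d q }
    ; P-sym = λ { (inj₁ q) → inj₁ (P-sym g q)
                ; (inj₂ (s , t , l , eq , eq′)) → inj₂ (matched-sym (s , t , l , eq , eq′)) }
    ; P-unique = λ { (inj₁ q) (inj₁ r) → P-unique g q r
                   ; (inj₁ q) (inj₂ r) → ⊥-elim (P-outC g q (matched-core r))
                   ; (inj₂ q) (inj₁ r) → ⊥-elim (P-outC g r (matched-core q))
                   ; (inj₂ q) (inj₂ r) → matched-unique p T-range T-apart q r }
    ; P-irrefl = λ { (inj₁ q) → P-irrefl g q
                   ; (inj₂ q) → matched-irrefl p T-range q }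
    ; P-free = λ { (inj₁ q) (here refl) → P-outC g q (j , j<L , refl)
                 ; (inj₁ q) (there r) → P-free g q r
                 ; (inj₂ (s , t , l , refl , _)) (here eq) → link-avoid l (inj p (link-range T-range l) j<L eq)
                 ; (inj₂ q) (there r) → C-free g (matched-core q) r }
    ; P-outC = λ { (inj₁ q) c → P-outC g q (C′⊆ c)
                 ; (inj₂ (s , t , l , refl , _)) c → outC l (C′⇒K c) }
    ; C-free = λ { c (here refl) → avoidC (C′⇒K c) ; c (there q) → C-free g (C′⊆ c) q }
    ; cover = cov
    }
    where
    open Split sp renaming (cover to split-cover)
    link-avoid : ∀ {s t} → Link T s t → s ≢ j
    link-avoid (inj₁ (q , refl)) = proj₁ (T-avoid q)
    link-avoid (inj₂ (q , refl)) = proj₂ (T-avoid q)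
    link-outK : ∀ {s t} → Link T s t → ¬ K s
    link-outK (inj₁ (q , refl)) = proj₁ (T-outK q)
    link-outK (inj₂ (q , refl)) = proj₂ (T-outK q)
    matched-core : ∀ {a b} → Matched w T a b → Core w L a
    matched-core (s , _ , l , eq , _) = s , link-range T-range l , eq
    C′⊆ : ∀ {v} → C′ v → Core w L v
    C′⊆ c = let (t , t<L , _ , eq) = C′⇒K c in t , t<L , eq
    outC : ∀ {s t} → Link T s t → ¬ (∃ λ u → u < L × K u × w u ≡ w s)
    outC l (u , u<L , k , eq) with refl ← inj p u<L (link-range T-range l) eq = link-outK l k
    avoidC : ¬ (∃ λ u → u < L × K u × w u ≡ w j)
    avoidC (u , u<L , k , eq) with refl ← inj p u<L j<L eq = K-avoid k
    cov : ∀ v → (∃ λ u → u ∈N v × u ∈ w i ∷ D) ⊎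
                (∃₂ λ a b → (P a b ⊎ Matched w T a b) × a ∈N v × b ∈N v) ⊎ C′ v
    cov v with cover g v
    ... | inj₁ (u , u∈N , u∈D) = inj₁ (u , u∈N , there u∈D)
    ... | inj₂ (inj₁ (a , b , Pab , a∈ , b∈)) = inj₂ (inj₁ (a , b , inj₁ Pab , a∈ , b∈))
    ... | inj₂ (inj₂ (t , t<L , refl)) with split-cover t t<L
    ...   | inj₁ close = inj₁ (w i , path-close p t<L i<L close , here refl)
    ...   | inj₂ (inj₂ k) = inj₂ (inj₂ (K⇒C′ t<L k))
    ...   | inj₂ (inj₁ (s , l)) = inj₂ (inj₁ (w t , w s , inj₂ (t , s , l , refl , refl) , inj₁ refl ,
                                    link-close p T-range l))

  reply-in-core : ∀ {w L j i m D S C P} → IsPath w L → Guard D S C P → C (w i) →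
                  i < L → j < L → i ≢ j → ¬ StallerWinsS G m (w i ∷ D) (w j ∷ S) →
                  ¬ StallerWinsD G m D (w j ∷ S)
  reply-in-core p g c i<L j<L i≢j =
    reply _ λ { (here eq) → i≢j (inj p i<L j<L eq) ; (there q) → C-free g c q }

  survive-even : ∀ {m w L j D S P} → IsPath w L → IsOdd L → 2 < L → IsEven j → j < L →
                 w j ∉ D → Guard D S (Core w L) P → ¬ StallerWinsD G m D (w j ∷ S)
  survive-even p oL 2<L ej j<L wj∉D g with split-none oL 2<L ej j<L
  ... | i , sp = reply-in-core p g (i , i<L , refl) i<L j<L i≢j
                   (survive-forever _ (guard-split (λ _ → ⊥) p sp (λ ()) (λ _ ()) wj∉D g))
    where open Split sp using (i<L; i≢j)

  survive-left : ∀ {m w L j D S P} → IsPath w L → IsOdd L → IsOdd j → j < L → w j ∉ D →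
                 (∀ {D S P} → Guard D S (Core w j) P → ¬ StallerWinsS G m D S) →
                 Guard D S (Core w L) P → ¬ StallerWinsD G m D (w j ∷ S)
  survive-left {j = j} p oL oj j<L wj∉D later g = reply-in-core p g (suc j , i<L , refl) i<L j<L i≢j
    (later (guard-split _ p sp (λ (t , t<j , eq) → t , <-trans t<j j<L , t<j , eq) (λ _ t<j → _ , t<j , refl) wj∉D g))
    where
    sp = split-left oL oj j<L
    open Split sp using (i<L; i≢j)

  survive-right : ∀ {m w L j r D S P} → L ≡ suc j + r → IsPath w L → IsOdd j → w j ∉ D →
                  (∀ {D S P} → Guard D S (Core (w ∘ (suc j +_)) r) P → ¬ StallerWinsS G m D S) →
                  Guard D S (Core w L) P → ¬ StallerWinsD G m D (w j ∷ S)
  survive-right {w = w} {j = j@(suc i)} {r} refl p oj wj∉D later g =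
    reply-in-core p g (i , i<L , refl) i<L j<L i≢j
      (later (guard-split _ p sp
        (λ (t , t<r , eq) → suc j + t , +-monoʳ-< (suc j) t<r , s≤s (m≤m+n j t) , eq) K⇒C′ wj∉D g))
    where
    sp = split-right oj (m≤m+n (suc j) r)
    open Split sp
    K⇒C′ : ∀ {t} → t < suc j + r → j < t → Core (w ∘ (suc j +_)) r (w t)
    K⇒C′ t<L j<t with m≤n⇒∃[o]m+o≡n j<t
    ... | u , refl = u , +-cancelˡ-< (suc j) _ _ t<L , refl

  -- A cut at an even position lets everything be paired. A cut at an odd `j` leaves pieces of `j`
  -- and `r` vertices, not both below half of `2 ^ m`; Dominator pairs up the other piece and keeps
  -- a long one as core.
  path-survive : ∀ m {w L D S P} → IsPath w L → IsOdd L → 2 ^ m ≤ L →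
                 Guard D S (Core w L) P → ¬ StallerWinsS G m D S
  path-survive (suc m) {w} {L} p oL 2^m≤L g =
    survive-step g (path-live p (<-trans (n<1+n 1) 2<L)) (path-survive m p oL (≤-trans M≤2M 2^m≤L)) onCore
    where
    M≤2M : 2 ^ m ≤ 2 ^ suc m
    M≤2M = ^-monoʳ-≤ 2 (n≤1+n m)
    2<L : 2 < L
    2<L = ≤∧≢⇒< (≤-trans (*-monoʳ-≤ 2 (m^n>0 2 m)) 2^m≤L) λ { refl → ¬even∧odd (suc (suc zero)) oL }
    onCore : ∀ x → Core w L x → x ∉ _ → ¬ StallerWinsD G m _ (x ∷ _)
    onCore _ (j , j<L , refl) wj∉D with even-or-odd j
    ... | inj₁ ej = survive-even p oL 2<L ej j<L wj∉D g
    ... | inj₂ oj with 2 ^ m ≤? j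
    ...   | yes M≤j = survive-left p oL oj j<L wj∉D (path-survive m (path-take (<⇒≤ j<L) p) oj M≤j) g
    ...   | no  M≰j with m≤n⇒∃[o]m+o≡n j<L
    ...     | r , refl = survive-right refl p oj wj∉D
                (path-survive m (path-drop (suc j) p) (even+⁻odd (suc oj) oL)
                  (path-split-bound (subst (_≤ suc j + r) (2^suc m) 2^m≤L) M≰j)) g

  -- Dominator's strategy on lollipops

  record IsLollipop (w : ℕ → V) (c n′ : ℕ) : Set where
    field
      walk  : IsPath w (suc (c + n′))
      chord : w (c + n′) ∈N w c × w c ∈N w (c + n′)

  open IsLollipop

  lollipop-drop : ∀ {w c n′} a → IsLollipop w (a + c) n′ → IsLollipop (w ∘ (a +_)) c n′
  lollipop-drop {w} {c} {n′} a l = record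
    { walk = path-drop a (subst (IsPath w) (trans (cong suc (+-assoc a c n′)) (sym (+-suc a (c + n′)))) (walk l))
    ; chord = subst (λ t → w t ∈N w (a + c) × w (a + c) ∈N w t) (+-assoc a c n′) (chord l)
    }

  -- Reversal exchanges the chord with the step from `c` to `c + 1`; steps on the stick stay and
  -- those inside the cycle part change direction.
  lollipop-reflect : ∀ {w c n′} → IsLollipop w c (suc n′) → IsLollipop (w ∘ reflect c (suc n′)) c (suc n′)
  lollipop-reflect {w} {c} {n} l = record
    { walk = record
        { inj = λ s<L t<L eq → reflect-injective s<L t<L (inj (walk l) (reflect-< s<L) (reflect-< t<L) eq)
        ; adj = λ {t} → adj′ t
        }
    ; chord = subst (λ s → w′ s ∈N w′ c × w′ c ∈N w′ s) (sym (+-suc c n))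
                (adjacent (suc (c + n)) c (trans (reflect-cycle c n 0 (cong suc (sym (+-identityʳ n)))) (cong suc (+-identityʳ c)))
                  (reflect-stick {c} ≤-refl)
                  (adj (walk l) (s≤s (m<m+n c z<s)) ))
    }
    where
    w′ : ℕ → V
    w′ = w ∘ reflect c (suc n)
    adjacent : ∀ s t {s′ t′} → reflect c (suc n) s ≡ s′ → reflect c (suc n) t ≡ t′ →
               w s′ ∈N w t′ × w t′ ∈N w s′ → w′ s ∈N w′ t × w′ t ∈N w′ s
    adjacent _ _ eq eq′ a rewrite eq | eq′ = a
    adj′ : ∀ t → suc t < suc (c + suc n) → w′ (suc t) ∈N w′ t × w′ t ∈N w′ (suc t)
    adj′ t lt with lollipop-position c (suc n) t (<-trans (n<1+n t) lt)
    ... | cycle i zero eq = contradiction lt (<-irrefl (cong suc (trans (sym (+-suc c i)) (cong (c +_) (sym (trans eq (cong suc (+-identityʳ i))))))))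
    ... | cycle i (suc i′) eq = let (a , b) = adj (walk l) (reflected-bound) in
            adjacent (suc (suc (c + i))) (suc (c + i))
                     (trans (cong (reflect c (suc n)) (cong suc (sym (+-suc c i)))) (reflect-cycle c (suc i) i′ (trans eq (cong suc (+-suc i i′)))))
                     (trans (reflect-cycle c i (suc i′) eq) (cong suc (+-suc c i′))) (b , a)
      where
      reflected-bound : suc (suc (c + i′)) < suc (c + suc n)
      reflected-bound = s≤s (subst (_≤ c + suc n) (trans (+-suc c (suc i′)) (cong suc (+-suc c i′)))
                         (+-monoʳ-≤ c (subst (suc (suc i′) ≤_) (sym eq) (s≤s (m≤n+m (suc i′) i)))))
    ... | stick t≤c with m≤n⇒m<n∨m≡n t≤c
    ...   | inj₁ t<c = adjacent (suc t) t (reflect-stick t<c) (reflect-stick t≤c) (adj (walk l) lt)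
    ...   | inj₂ refl = adjacent (suc t) c
                                 (trans (cong (reflect c (suc n) ∘ suc) (sym (+-identityʳ c))) (trans (reflect-cycle c 0 n refl) (sym (+-suc c n))))
                                 (reflect-stick {c} ≤-refl) (chord l)

  guard-core-≡ : ∀ {D S C C′ P} → (∀ {v} → C v → C′ v) → (∀ {v} → C′ v → C v) → Guard D S C P → Guard D S C′ P
  guard-core-≡ to from g = record
    { disjoint = disjoint g
    ; P-sym = P-sym g
    ; P-unique = P-unique g
    ; P-irrefl = P-irrefl g
    ; P-free = P-free g
    ; P-outC = λ p → P-outC g p ∘ from
    ; C-free = C-free g ∘ from
    ; cover = λ v → [ inj₁ , [ inj₂ ∘ inj₁ , inj₂ ∘ inj₂ ∘ to ] ] (cover g v)
    }

  core-reflect : ∀ {w c n′ v} → Core w (suc (c + n′)) v → Core (w ∘ reflect c n′) (suc (c + n′)) v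
  core-reflect {w} {c} {n′} (t , t<L , eq) = reflect c n′ t , reflect-< t<L , trans (cong w (reflect-involutive t<L)) eq

  core-unreflect : ∀ {w c n′ v} → Core (w ∘ reflect c n′) (suc (c + n′)) v → Core w (suc (c + n′)) v
  core-unreflect {c = c} {n′} (t , t<L , eq) = reflect c n′ t , reflect-< t<L , eq

  -- Here `c + h + 2 ^ p` plays the role that the number of vertices has for a path: after every
  -- cut, some piece that Dominator can keep has at least half of the required size.
  lollipop-survive : ∀ m {w c n′ h p D S P} → IsLollipop w c n′ → IsOdd c → suc n′ ≡ h + h →
                     2 ^ p < h + h → 2 ^ m ≤ c + h + 2 ^ p →
                     Guard D S (Core w (suc (c + n′))) P → ¬ StallerWinsS G m D S
  lollipop-survive m {n′ = zero} {suc h} l oc eq q<2h bound g = λ _ → contradiction (trans eq (cong suc (+-suc h h))) λ ()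
  lollipop-survive (suc m) {w} {c} {suc n} {h} {p} l oc eq q<2h bound g =
    survive-step g (path-live (walk l) (<-trans (n<1+n 1) 2<L))
      (lollipop-survive m {h = h} {p} l oc eq q<2h (≤-trans (^-monoʳ-≤ 2 (n≤1+n m)) bound)) onCore
    where
    L = suc (c + suc n)
    bound′ : 2 ^ m + 2 ^ m ≤ c + h + 2 ^ p
    bound′ = subst (_≤ c + h + 2 ^ p) (2^suc m) bound
    on : IsOdd (suc n)
    on = double-pred-odd h eq
    oL : IsOdd L
    oL = suc (odd+odd oc on)
    2<L : 2 < L
    2<L = s≤s (+-mono-≤ (odd⇒>0 oc) (s≤s z≤n))
    onCore : ∀ x → Core w L x → x ∉ _ → ¬ StallerWinsD G m _ (x ∷ _)
    onCore _ (j , j<L , refl) wj∉D with even-or-odd j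
    ... | inj₁ ej = survive-even (walk l) oL 2<L ej j<L wj∉D g
    ... | inj₂ oj with 2 ^ m ≤? j
    ...   | yes M≤j = survive-left (walk l) oL oj j<L wj∉D (path-survive m (path-take (<⇒≤ j<L) (walk l)) oj M≤j) g
    ...   | no  M≰j with lollipop-position c (suc n) j j<L
    -- The direct path to the cut is short, so Dominator keeps the path running the other way
    -- around, the left piece of the reversed lollipop.
    ...     | cycle i i′ eq′ = subst (λ x → ¬ StallerWinsD G m _ (x ∷ _)) (cong w wj′≡wj)
                (survive-left (walk l′) oL oj′ j′<L (subst (_∉ _) (cong w (sym wj′≡wj)) wj∉D)
                  (path-survive m (path-take (<⇒≤ j′<L) (walk l′)) oj′
                    (cycle-bound {p} {m} {c} {h} {i} {i′} (trans (cong suc (sym eq′)) eq) q<2h bound′ M≰j))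
                  (guard-core-≡ core-reflect core-unreflect g))
      where
      l′ = lollipop-reflect l
      wj′≡wj : reflect c (suc n) (suc (c + i′)) ≡ suc (c + i)
      wj′≡wj = reflect-cycle c i′ i (trans eq′ (cong suc (+-comm i i′)))
      j′<L : suc (c + i′) < L
      j′<L = subst (λ k → suc (c + i′) < suc (c + k)) (sym eq′) (s≤s (+-monoʳ-< c (s≤s (m≤n+m i′ i))))
      oj′ : IsOdd (suc (c + i′))
      oj′ = suc (odd+odd oc (cycle-arcs-odd oc oj (subst IsOdd eq′ on)))
    ...     | stick j≤c with m≤n⇒m<n∨m≡n j≤c
    -- A cut at the junction with a short stick: the path formed by the rest of the cycle is kept.
    ...       | inj₂ refl = survive-right refl (walk l) oc wj∉D
                  (path-survive m (path-drop (suc c) (walk l)) on (junction-bound {p} {m} {c} {h} eq q<2h bound′ M≰j)) g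
    -- A cut on the stick with a short left piece: a lollipop with the same cycle is kept.
    ...       | inj₁ j<c with m≤n⇒∃[o]m+o≡n j<c
    ...         | c′ , refl = survive-right (cong suc (trans (cong suc (+-assoc j c′ (suc n))) (sym (+-suc j (c′ + suc n))))) (walk l) oj wj∉D
                  (lollipop-survive m {h = h} {p} (lollipop-drop (suc j) l) (even+⁻odd (suc oj) oc) eq q<2h
                    (path-split-bound (subst (2 ^ m + 2 ^ m ≤_)
                      (trans (+-assoc (suc j + c′) h _) (trans (+-assoc (suc j) c′ _) (cong (suc j +_) (sym (+-assoc c′ h _)))))
                      bound′) M≰j)) g

  -- Staller's strategy on paths

  record Unplayed (w : ℕ → V) (L : ℕ) (D S : List V) : Set where
    field
      distinct : ∀ {s t} → s < L → t < L → w s ≡ w t → s ≡ t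
      free-D   : ∀ {t} → t < L → w t ∉ D
      free-S   : ∀ {t} → t < L → w t ∉ S
      separate : ∀ {v} → v ∈ D → v ∉ S

  unplayed-take : ∀ {w L j D S} → j < L → Unplayed w L D S → Unplayed w j D (w j ∷ S)
  unplayed-take j<L u = record
    { distinct = λ s<j t<j → distinct (<-trans s<j j<L) (<-trans t<j j<L)
    ; free-D = λ t<j → free-D (<-trans t<j j<L)
    ; free-S = λ { t<j (here eq) → <-irrefl (distinct (<-trans t<j j<L) j<L eq) t<j
                 ; t<j (there q) → free-S (<-trans t<j j<L) q }
    ; separate = λ { p (here refl) → free-D j<L p ; p (there q) → separate p q }
    }
    where open Unplayed u

  unplayed-drop : ∀ {w j r D S} → Unplayed w (suc j + r) D S → Unplayed (w ∘ (suc j +_)) r D (w j ∷ S)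
  unplayed-drop {w} {j} {r} u = record
    { distinct = λ s<r t<r eq → +-cancelˡ-≡ (suc j) _ _ (distinct (+-monoʳ-< (suc j) s<r) (+-monoʳ-< (suc j) t<r) eq)
    ; free-D = λ t<r → free-D (+-monoʳ-< (suc j) t<r)
    ; free-S = λ { {t} t<r (here eq) → m≢1+m+n j (sym (distinct (+-monoʳ-< (suc j) t<r) j<L eq))
                 ; t<r (there q) → free-S (+-monoʳ-< (suc j) t<r) q }
    ; separate = λ { p (here refl) → free-D j<L p ; p (there q) → separate p q }
    }
    where
    open Unplayed u
    j<L : j < suc j + r
    j<L = m≤m+n (suc j) r

  unplayed-avoid : ∀ {w L D S y} → ¬ Core w L y → y ∉ S → Unplayed w L D S → Unplayed w L (y ∷ D) S
  unplayed-avoid ¬core y∉S u = record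
    { distinct = distinct
    ; free-D = λ { t<L (here refl) → ¬core (_ , t<L , refl) ; t<L (there p) → free-D t<L p }
    ; free-S = free-S
    ; separate = λ { (here refl) → y∉S ; (there p) → separate p }
    }
    where open Unplayed u

  data Near (w : ℕ → V) (L : ℕ) : ℕ → V → Set where
    at   : ∀ {t} → Near w L t (w t)
    next : ∀ {t} → suc t < L → Near w L t (w (suc t))
    prev : ∀ {t} → Near w L (suc t) (w t)

  -- The only neighbour lost by the cut is `w j`, which Staller has just played.
  near-take : ∀ {w L j t v S} → t < j → Near w L t v → v ∈ w j ∷ S ⊎ Near w j t v
  near-take t<j at = inj₂ at
  near-take t<j (next _) with m≤n⇒m<n∨m≡n t<j
  ... | inj₁ lt   = inj₂ (next lt)
  ... | inj₂ refl = inj₁ (here refl)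
  near-take t<j prev = inj₂ prev

  near-drop : ∀ {w j r v S u} t → u ≡ suc j + t → Near w (suc j + r) u v →
              v ∈ w j ∷ S ⊎ Near (w ∘ (suc j +_)) r t v
  near-drop t refl at = inj₂ at
  near-drop {w} {j} {r} t refl (next lt) = inj₂ (subst (Near (w ∘ (suc j +_)) r t) (cong w (+-suc (suc j) t))
    (next (+-cancelˡ-< (suc j) _ _ (subst (_< suc j + r) (sym (+-suc (suc j) t)) lt))))
  near-drop {w} {j} zero eq prev = inj₁ (here (cong w (trans (suc-injective eq) (+-identityʳ j))))
  near-drop {w} {j} (suc t) eq prev =
    inj₂ (subst (Near _ _ (suc t)) (cong w (sym (trans (suc-injective eq) (+-suc j t)))) prev)

  -- Only the closed neighbourhoods of the even positions matter to Staller.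
  record StallerPath (w : ℕ → V) (L : ℕ) (D S : List V) : Set where
    field
      unplayed : Unplayed w L D S
      closed   : ∀ {t v} → IsEven t → t < L → v ∈N w t → v ∈ S ⊎ Near w L t v

  open StallerPath

  staller-avoid : ∀ {w L D S y} → ¬ Core w L y → y ∉ S → StallerPath w L D S → StallerPath w L (y ∷ D) S
  staller-avoid ¬core y∉S p = record { unplayed = unplayed-avoid ¬core y∉S (unplayed p) ; closed = closed p }

  staller-take : ∀ {w L j D S} → j < L → StallerPath w L D S → StallerPath w j D (w j ∷ S)
  staller-take j<L p = record
    { unplayed = unplayed-take j<L (unplayed p)
    ; closed = λ e t<j v∈N → [ inj₁ ∘ there , near-take t<j ] (closed p e (<-trans t<j j<L) v∈N)
    }

  -- Since `suc j` is even, the even positions of the right piece are even positions of the whole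
  -- path.
  staller-drop : ∀ {w j r D S} → IsOdd j → StallerPath w (suc j + r) D S → StallerPath (w ∘ (suc j +_)) r D (w j ∷ S)
  staller-drop {j = j} oj p = record
    { unplayed = unplayed-drop (unplayed p)
    ; closed = λ {t} e t<r v∈N → [ inj₁ ∘ there , near-drop t refl ]
                 (closed p (even+even (suc oj) e) (+-monoʳ-< (suc j) t<r) v∈N)
    }

  -- One piece after a cut is fixed. An answer off this piece leaves it intact, and an answer on it
  -- has to be met elsewhere. The game is not over, as no vertex of Dominator dominates position 0.
  play-elsewhere : ∀ {m w L D S} → StallerPath w L D S → IsOdd L →
    (∀ {D} → StallerPath w L D S → StallerWinsS G m D S) →
    (∀ y → y ∉ S → Core w L y → StallerWinsS G m (y ∷ D) S) →
    StallerWinsD G m D S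
  play-elsewhere {m} {w} {L} {D} {S} p (suc _) win onPath =
    dmoves (λ dom → let (v , v∈N , v∈D) = dom (w 0) in undominated (closed p zero z<s v∈N) v∈D)
           (w 0 , free-D z<s , free-S z<s) next-move
    where
    open Unplayed (unplayed p)
    undominated : ∀ {v} → v ∈ S ⊎ Near w L 0 v → v ∉ D
    undominated (inj₁ v∈S) v∈D = separate v∈D v∈S
    undominated (inj₂ at) = free-D z<s
    undominated (inj₂ (next lt)) = free-D lt
    next-move : ∀ y → y ∉ D → y ∉ S → StallerWinsS G m (y ∷ D) S
    next-move y _ y∉S with anyUpTo? (λ t → w t ≟ y) L
    ... | yes core = onPath y y∉S core
    ... | no ¬core = win (staller-avoid ¬core y∉S p)

  after-cut : ∀ {w j r} {u : V} → (∀ {s t} → s < suc j + r → t < suc j + r → w s ≡ w t → s ≡ t) →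
              Core w j u → ¬ Core (w ∘ (suc j +_)) r u
  after-cut {j = j} {r} distinct (s , s<j , eq) (t , t<r , eq′) =
    <⇒≱ s<j (subst (j ≤_) (sym (distinct (<-≤-trans s<j (≤-trans (n≤1+n j) (m≤m+n (suc j) r))) (+-monoʳ-< (suc j) t<r) (trans eq (sym eq′))))
               (≤-trans (n≤1+n j) (m≤m+n (suc j) t)))

  -- A cut leaves two odd pieces that are both short enough, and Dominator's answer can touch only
  -- one. On a single vertex, Staller already owns all its neighbours.
  path-win : ∀ m {w L D S} → IsOdd L → L < 2 ^ m → StallerPath w L D S → StallerWinsS G m D S
  path-win zero (suc e) (s≤s ()) p
  path-win (suc m) {w} {L} {D} {S} oL L<2M p with 1 <? L
  ... | no ¬1<L with oL
  ...   | suc {zero} _ = smove (w 0) (free-D z<s) (free-S z<s) (inj₁ (w 0 , λ v v∈N → claimed (closed p zero z<s v∈N)))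
    where
    open Unplayed (unplayed p)
    claimed : ∀ {v} → v ∈ S ⊎ Near w 1 0 v → v ∈ w 0 ∷ S
    claimed (inj₁ v∈S) = there v∈S
    claimed (inj₂ at) = here refl
    claimed (inj₂ (next (s≤s ())))
  ...   | suc {suc _} _ = contradiction (s≤s z<s) ¬1<L
  path-win (suc m) {w} {L} {D} {S} oL L<2M p | yes 1<L with path-cut m oL 1<L L<2M
  ... | j , r , oj , refl , j<M , r<M =
    smove (w j) (free-D j<L) (free-S j<L) (inj₂ (play-elsewhere (staller-take j<L p) oj (path-win m oj j<M)
      λ y y∉S core → path-win m or r<M (staller-avoid (after-cut distinct core) y∉S (staller-drop oj p))))
    where
    open Unplayed (unplayed p)
    j<L : j < suc j + r
    j<L = m≤m+n (suc j) r
    or : IsOdd r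
    or = even+⁻odd (suc oj) oL

  -- Staller's strategy on lollipops

  -- In contrast to `StallerPath`, neighbourhoods at both parities are recorded, because the double
  -- threat aims at two consecutive positions. The last alternative is the chord, seen from the end
  -- of the cycle.
  record StallerLollipop (w : ℕ → V) (c n′ : ℕ) (D S : List V) : Set where
    field
      unplayed : Unplayed w (suc (c + n′)) D S
      closed   : ∀ {t v} → t ≢ c → t < suc (c + n′) → v ∈N w t →
                 v ∈ S ⊎ Near w (suc (c + n′)) t v ⊎ (t ≡ c + n′ × v ≡ w c)

  open StallerLollipop

  -- An even position is not the odd junction `c`, and the far end `c + n′` of the chord is not
  -- before the cut, so the chord disturbs no neighbourhood that matters.
  staller-lollipop-left : ∀ {w c n′ j D S} → IsOdd c → IsOdd j → j < suc (c + n′) →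
                          StallerLollipop w c n′ D S → StallerPath w j D (w j ∷ S)
  staller-lollipop-left {w} {c} {n′} {j} {D} {S} oc oj j<L l = record
    { unplayed = unplayed-take j<L (unplayed l)
    ; closed = λ e t<j v∈N → near t<j (closed l (λ { refl → ¬even∧odd e oc }) (<-trans t<j j<L) v∈N)
    }
    where
    near : ∀ {t v} → t < j → v ∈ S ⊎ Near w (suc (c + n′)) t v ⊎ (t ≡ c + n′ × v ≡ w c) →
           v ∈ w j ∷ S ⊎ Near w j t v
    near t<j (inj₁ v∈S) = inj₁ (there v∈S)
    near t<j (inj₂ (inj₁ n)) = near-take t<j n
    near t<j (inj₂ (inj₂ (refl , _))) = contradiction (≤-pred j<L) (<⇒≱ t<j)

  -- The junction now belongs to Staller, so the chord contributes only a vertex that she owns.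
  staller-lollipop-cycle : ∀ {w c n′ D S} → IsOdd c → StallerLollipop w c n′ D S →
                           StallerPath (w ∘ (suc c +_)) n′ D (w c ∷ S)
  staller-lollipop-cycle {w} {c} {n′} {D} {S} oc l = record
    { unplayed = unplayed-drop (unplayed l)
    ; closed = λ {t} e t<n′ v∈N → near t (closed l (λ eq → m≢1+m+n c (sym eq)) (+-monoʳ-< (suc c) t<n′) v∈N)
    }
    where
    near : ∀ t {v} → v ∈ S ⊎ Near w (suc (c + n′)) (suc c + t) v ⊎ (suc c + t ≡ c + n′ × v ≡ w c) →
           v ∈ w c ∷ S ⊎ Near (w ∘ (suc c +_)) n′ t v
    near t (inj₁ v∈S) = inj₁ (there v∈S)
    near t (inj₂ (inj₁ n)) = near-drop t refl n
    near t (inj₂ (inj₂ (_ , eq))) = inj₁ (here eq)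

  stick-length : ∀ j c n′ → suc (suc j + c + n′) ≡ suc j + suc (c + n′)
  stick-length j c n′ = trans (cong suc (+-assoc (suc j) c n′)) (sym (+-suc (suc j) (c + n′)))

  staller-lollipop-drop : ∀ {w c n′ D S} j → StallerLollipop w (suc j + c) n′ D S →
                          StallerLollipop (w ∘ (suc j +_)) c n′ D (w j ∷ S)
  staller-lollipop-drop {w} {c} {n′} {D} {S} j l = record
    { unplayed = unplayed-drop (subst (λ L → Unplayed w L D S) (stick-length j c n′) (unplayed l))
    ; closed = λ {t} t≢c t<L v∈N → near t (closed l (t≢c ∘ +-cancelˡ-≡ (suc j) _ _)
                 (subst (suc j + t <_) (sym (stick-length j c n′)) (+-monoʳ-< (suc j) t<L)) v∈N)
    }
    where
    near : ∀ t {v} → v ∈ S ⊎ Near w (suc (suc j + c + n′)) (suc j + t) v ⊎ (suc j + t ≡ suc j + c + n′ × v ≡ w (suc j + c)) →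
           v ∈ w j ∷ S ⊎ Near (w ∘ (suc j +_)) (suc (c + n′)) t v ⊎ (t ≡ c + n′ × v ≡ w (suc j + c))
    near t (inj₁ v∈S) = inj₁ (there v∈S)
    near t {v} (inj₂ (inj₁ n)) with near-drop t refl (subst (λ L → Near w L (suc j + t) v) (stick-length j c n′) n)
    ... | inj₁ v∈S = inj₁ v∈S
    ... | inj₂ n′ = inj₂ (inj₁ n′)
    near t (inj₂ (inj₂ (eq , eq′))) = inj₂ (inj₂ (+-cancelˡ-≡ (suc j) _ _ (trans eq (+-assoc (suc j) c n′)) , eq′))

  unplayed-reflect : ∀ {w c n′ D S} → Unplayed w (suc (c + n′)) D S → Unplayed (w ∘ reflect c n′) (suc (c + n′)) D S
  unplayed-reflect u = record
    { distinct = λ s<L t<L eq → reflect-injective s<L t<L (distinct (reflect-< s<L) (reflect-< t<L) eq)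
    ; free-D = free-D ∘ reflect-<
    ; free-S = free-S ∘ reflect-<
    ; separate = separate
    }
    where open Unplayed u

  staller-lollipop-reflect : ∀ {w c n D S} → StallerLollipop w c (suc n) D S →
                             StallerLollipop (w ∘ reflect c (suc n)) c (suc n) D S
  staller-lollipop-reflect {w} {c} {n} {D} {S} l = record
    { unplayed = unplayed-reflect (unplayed l)
    ; closed = λ {t} t≢c t<L v∈N → near t t≢c t<L (closed l (reflect≢c t t≢c t<L) (reflect-< t<L) v∈N)
    }
    where
    L = suc (c + suc n)
    ρ = reflect c (suc n)
    reflect≢c : ∀ t → t ≢ c → t < L → ρ t ≢ c
    reflect≢c t t≢c t<L eq = t≢c (trans (sym (reflect-involutive t<L)) (trans (cong ρ eq) (reflect-stick {c} ≤-refl)))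
    near : ∀ t {v} → t ≢ c → t < L → v ∈ S ⊎ Near w L (ρ t) v ⊎ (ρ t ≡ c + suc n × v ≡ w c) →
           v ∈ S ⊎ Near (w ∘ ρ) L t v ⊎ (t ≡ c + suc n × v ≡ w (ρ c))
    near t t≢c t<L (inj₁ v∈S) = inj₁ v∈S
    near t {v} t≢c t<L (inj₂ x) with lollipop-position c (suc n) t t<L
    ... | stick t≤c = inj₂ (inj₁ (on-stick (≤∧≢⇒< t≤c t≢c) (reflect-stick t≤c) x))
      where
      on-stick : ∀ {t u v} → t < c → u ≡ t → Near w L u v ⊎ (u ≡ c + suc n × v ≡ w c) → Near (w ∘ ρ) L t v
      on-stick t<c refl (inj₂ (refl , _)) = contradiction (m≤m+n c (suc n)) (<⇒≱ t<c)
      on-stick {t} t<c refl (inj₁ at) = subst (Near _ _ t) (cong w (reflect-stick (<⇒≤ t<c))) at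
      on-stick {t} t<c refl (inj₁ (next lt)) = subst (Near _ _ t) (cong w (reflect-stick t<c)) (next lt)
      on-stick {suc s} t<c refl (inj₁ prev) = subst (Near _ _ (suc s)) (cong w (reflect-stick (≤-trans (n≤1+n s) (<⇒≤ t<c)))) prev
    ... | cycle i i′ eq = inj₂ (on-cycle i i′ eq (reflect-cycle c i i′ eq) x)
      where
      on-cycle : ∀ {u v} i i′ → suc n ≡ suc (i + i′) → u ≡ suc (c + i′) → Near w L u v ⊎ (u ≡ c + suc n × v ≡ w c) →
                 Near (w ∘ ρ) L (suc (c + i)) v ⊎ (suc (c + i) ≡ c + suc n × v ≡ w (ρ c))
      on-cycle i i′ eq refl (inj₁ at) = inj₁ (subst (Near _ _ (suc (c + i))) (cong w (reflect-cycle c i i′ eq)) at)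
      on-cycle zero i′ eq refl (inj₁ (next lt)) =
        contradiction lt (<-irrefl (cong suc (trans (sym (+-suc c i′)) (cong (c +_) (sym eq)))))
      on-cycle (suc i) i′ eq refl (inj₁ (next lt)) =
        inj₁ (subst (Near (w ∘ ρ) L (suc (c + suc i))) (cong w (trans (cong ρ (+-suc c i))
          (trans (reflect-cycle c i (suc i′) (trans eq (cong suc (sym (+-suc i i′))))) (cong suc (+-suc c i′))))) prev)
      on-cycle i zero eq u≡ (inj₁ (prev {s})) = inj₂
        ( trans (sym (+-suc c i)) (cong (c +_) (trans (cong suc (sym (+-identityʳ i))) (sym eq)))
        , cong w (trans (trans (suc-injective u≡) (+-identityʳ c)) (sym (reflect-stick {c} ≤-refl))))
      on-cycle i (suc i′) eq u≡ (inj₁ (prev {s})) =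
        inj₁ (subst (Near (w ∘ ρ) L (suc (c + i))) (cong w (trans (cong ρ (cong suc (sym (+-suc c i))))
          (trans (reflect-cycle c (suc i) i′ (trans eq (cong suc (+-suc i i′)))) (sym (trans (suc-injective u≡) (+-suc c i′))))))
          (next (s≤s (subst (_≤ c + suc n) (trans (+-suc c (suc i)) (cong suc (+-suc c i))) (+-monoʳ-≤ c
            (subst (suc (suc i) ≤_) (sym (trans eq (cong suc (+-suc i i′)))) (s≤s (s≤s (m≤m+n i i′)))))))))
      on-cycle (suc i) i′ eq refl (inj₂ (u≡ , v≡)) = contradiction
        (trans (suc-injective eq) (cong suc (+-comm i i′))) λ n≡ → m≢1+m+n i′ (trans (suc-injective (+-cancelˡ-≡ c _ _ (trans (+-suc c i′) u≡))) n≡)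
      on-cycle zero i′ eq refl (inj₂ (u≡ , refl)) =
        inj₁ (subst (Near (w ∘ ρ) L (suc (c + 0))) (cong w (trans (cong ρ (+-identityʳ c)) (reflect-stick {c} ≤-refl))) prev)

  -- Staller owns `w (3 + k)` and adds `w (2 + k)`. Then only `w (1 + k)` is missing around the
  -- latter and only `w (4 + k)` around the former. The bounds on `k` keep both centres away from
  -- the junction and from the end of the cycle.
  double-threat : ∀ {m w c n′ k D S y} → StallerLollipop w c n′ D S →
                  c < suc k → 4 + k < suc (c + n′) → y ∉ w (3 + k) ∷ S →
                  y ≢ w (1 + k) → y ≢ w (2 + k) → y ≢ w (4 + k) →
                  StallerWinsS G (2 + m) (y ∷ D) (w (3 + k) ∷ S)
  double-threat {m} {w} {c} {n′} {k} {D} {S} {y} l c<k+1 k+4<L y∉S y≢w₁ y≢w₂ y≢w₄ =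
    smove w₂ (λ { (here eq) → y≢w₂ (sym eq) ; (there p) → free-D k+2<L p })
             (λ { (here eq) → differ ≤-refl k+3<L eq ; (there q) → free-S k+2<L q })
             (inj₂ (dmoves (λ dom → let (v , v∈N , v∈D) = dom w₃ in undominated (around₃ v∈N) v∈D)
                           (w₄ , w₄∉D , w₄∉S) finish))
    where
    open Unplayed (unplayed l)
    L = suc (c + n′)
    w₁ w₂ w₃ w₄ : V
    w₁ = w (1 + k)
    w₂ = w (2 + k)
    w₃ = w (3 + k)
    w₄ = w (4 + k)
    k+3<L : 3 + k < L
    k+3<L = <-trans (n<1+n _) k+4<L
    k+2<L : 2 + k < L
    k+2<L = <-trans (n<1+n _) k+3<L
    k+1<L : 1 + k < L
    k+1<L = <-trans (n<1+n _) k+2<L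
    differ : ∀ {s t} → s < t → t < L → w s ≢ w t
    differ s<t t<L eq = <-irrefl (distinct (<-trans s<t t<L) t<L eq) s<t
    around : ∀ {t v} → v ∈ S ⊎ Near w L (suc t) v ⊎ (suc t ≡ c + n′ × v ≡ w c) → 2 + t < L →
             v ∈ S ⊎ v ≡ w t ⊎ v ≡ w (suc t) ⊎ v ≡ w (2 + t)
    around (inj₁ v∈S) _ = inj₁ v∈S
    around (inj₂ (inj₁ at)) _ = inj₂ (inj₂ (inj₁ refl))
    around (inj₂ (inj₁ (next _))) _ = inj₂ (inj₂ (inj₂ refl))
    around (inj₂ (inj₁ prev)) _ = inj₂ (inj₁ refl)
    around (inj₂ (inj₂ (eq , _))) lt = contradiction lt (<-irrefl (cong suc eq))
    around₂ : ∀ {v} → v ∈N w₂ → v ∈ S ⊎ v ≡ w₁ ⊎ v ≡ w₂ ⊎ v ≡ w₃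
    around₂ v∈N = around (closed l (λ { refl → <⇒≱ c<k+1 (n≤1+n _) }) k+2<L v∈N) k+3<L
    around₃ : ∀ {v} → v ∈N w₃ → v ∈ S ⊎ v ≡ w₂ ⊎ v ≡ w₃ ⊎ v ≡ w₄
    around₃ v∈N = around (closed l (λ { refl → <⇒≱ c<k+1 (≤-trans (n≤1+n _) (n≤1+n _)) }) k+3<L v∈N) k+4<L
    w₄∉D : w₄ ∉ y ∷ D
    w₄∉D (here eq) = y≢w₄ (sym eq)
    w₄∉D (there p) = free-D k+4<L p
    w₄∉S : w₄ ∉ w₂ ∷ w₃ ∷ S
    w₄∉S (here eq) = differ (n≤1+n _) k+4<L (sym eq)
    w₄∉S (there (here eq)) = differ ≤-refl k+4<L (sym eq)
    w₄∉S (there (there q)) = free-S k+4<L q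
    undominated : ∀ {v} → v ∈ S ⊎ v ≡ w₂ ⊎ v ≡ w₃ ⊎ v ≡ w₄ → v ∉ y ∷ D
    undominated (inj₁ v∈S) (here refl) = y∉S (there v∈S)
    undominated (inj₁ v∈S) (there p) = separate p v∈S
    undominated (inj₂ (inj₁ refl)) (here eq) = y≢w₂ (sym eq)
    undominated (inj₂ (inj₁ refl)) (there p) = free-D k+2<L p
    undominated (inj₂ (inj₂ (inj₁ refl))) (here eq) = y∉S (here (sym eq))
    undominated (inj₂ (inj₂ (inj₁ refl))) (there p) = free-D k+3<L p
    undominated (inj₂ (inj₂ (inj₂ refl))) = w₄∉D
    finish : ∀ z → z ∉ y ∷ D → z ∉ w₂ ∷ w₃ ∷ S → StallerWinsS G (suc m) (z ∷ y ∷ D) (w₂ ∷ w₃ ∷ S)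
    finish z _ _ with z ≟ w₁
    ... | yes refl = smove w₄ (λ { (here eq) → differ (≤-trans (n≤1+n _) (n≤1+n _)) k+4<L (sym eq) ; (there p) → w₄∉D p }) w₄∉S
            (inj₁ (w₃ , λ v v∈N → claim (around₃ v∈N)))
      where
      claim : ∀ {v} → v ∈ S ⊎ v ≡ w₂ ⊎ v ≡ w₃ ⊎ v ≡ w₄ → v ∈ w₄ ∷ w₂ ∷ w₃ ∷ S
      claim (inj₁ v∈S) = there (there (there v∈S))
      claim (inj₂ (inj₁ eq)) = there (here eq)
      claim (inj₂ (inj₂ (inj₁ eq))) = there (there (here eq))
      claim (inj₂ (inj₂ (inj₂ eq))) = here eq
    ... | no z≢w₁ = smove w₁
            (λ { (here eq) → z≢w₁ (sym eq) ; (there (here eq)) → y≢w₁ (sym eq) ; (there (there p)) → free-D k+1<L p })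
            (λ { (here eq) → differ ≤-refl k+2<L eq ; (there (here eq)) → differ (n≤1+n _) k+3<L eq ; (there (there q)) → free-S k+1<L q })
            (inj₁ (w₂ , λ v v∈N → claim (around₂ v∈N)))
      where
      claim : ∀ {v} → v ∈ S ⊎ v ≡ w₁ ⊎ v ≡ w₂ ⊎ v ≡ w₃ → v ∈ w₁ ∷ w₂ ∷ w₃ ∷ S
      claim (inj₁ v∈S) = there (there (there v∈S))
      claim (inj₂ (inj₁ eq)) = here eq
      claim (inj₂ (inj₂ (inj₁ eq))) = there (here eq)
      claim (inj₂ (inj₂ (inj₂ eq))) = there (there (here eq))

  -- Staller plays the cycle vertex at position j = 3 + k. An answer outside positions 0, …, j - 1 leaves her the
  -- direct path, an answer at j - 1 or j - 2 the reversed one; no other answer parries the double threat.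
  cycle-win : ∀ {m w c i i′ n D S} → n ≡ suc (suc (suc i) + suc i′) → 2 < m → IsOdd c → IsOdd n →
              IsOdd (suc (c + suc (suc i))) → suc (c + suc (suc i)) < 2 ^ m → suc (c + suc i′) < 2 ^ m →
              StallerLollipop w c n D S → StallerWinsS G (suc m) D S
  cycle-win {suc zero} _ (s≤s ())
  cycle-win {suc (suc m)} {w} {c} {i} {i′} {n} {D} {S} refl _ oc on oj₀ j<M₀ j′<M l =
    smove (w j) (free-D j<L) (free-S j<L)
      (inj₂ (play-elsewhere (staller-lollipop-left oc oj j<L l) oj (path-win (2 + m) oj j<M) onPath))
    where
    open Unplayed (unplayed l)
    k j j′ L : ℕ
    k = c + i
    j = 3 + k
    j′ = suc (c + suc i′)
    L = suc (c + n)
    ρ = reflect c n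
    j≡ : suc (c + suc (suc i)) ≡ j
    j≡ = cong suc (trans (+-suc c (suc i)) (cong suc (+-suc c i)))
    oj : IsOdd j
    oj = subst IsOdd j≡ oj₀
    j<M : j < 2 ^ (2 + m)
    j<M = subst (_< 2 ^ (2 + m)) j≡ j<M₀
    L≡ : ∀ c i i′ → 5 + (c + i) + i′ ≡ suc (c + suc (suc (suc i) + suc i′))
    L≡ = solve-∀
    j+1<L : suc j < L
    j+1<L = subst (suc j <_) (L≡ c i i′) (m≤m+n (5 + k) i′)
    j<L : j < L
    j<L = <-trans (n<1+n j) j+1<L
    oj′ : IsOdd j′
    oj′ = suc (odd+odd oc (cycle-arcs-odd {c} oc oj₀ on))
    j′+2<L : 2 + j′ < L
    j′+2<L = subst (2 + j′ <_) (arith c i i′) (m≤m+n (3 + j′) i)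
      where
      arith : ∀ c i i′ → 3 + suc (c + suc i′) + i ≡ suc (c + suc (suc (suc i) + suc i′))
      arith = solve-∀
    ρ₀ : ρ j′ ≡ j
    ρ₀ = trans (reflect-cycle c (suc i′) (suc (suc i)) (cong suc (+-comm (suc (suc i)) (suc i′)))) j≡
    -- Positions `j - 1` and `j - 2` come after the cut `j′` in the reversed lollipop, so an answer
    -- there does not touch the reversed path.
    ρ₁ : ρ (1 + j′) ≡ 2 + k
    ρ₁ = trans (cong (ρ ∘ suc) (sym (+-suc c (suc i′))))
           (trans (reflect-cycle c (2 + i′) (suc i) (arith i i′)) (cong suc (+-suc c i)))
      where
      arith : ∀ a b → suc (suc (suc a) + suc b) ≡ suc ((2 + b) + suc a)
      arith a b = cong suc (trans (sym (+-suc (suc a) (suc b))) (+-comm (suc a) (2 + b)))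
    ρ₂ : ρ (2 + j′) ≡ 1 + k
    ρ₂ = trans (cong (ρ ∘ suc) (sym (trans (+-suc c (suc (suc i′))) (cong suc (+-suc c (suc i′))))))
           (reflect-cycle c (3 + i′) i (arith i i′))
      where
      arith : ∀ a b → suc (suc (suc a) + suc b) ≡ suc ((3 + b) + a)
      arith a b = cong suc (trans (sym (+-suc (suc a) (suc b))) (trans (sym (+-suc a (2 + b))) (+-comm a (3 + b))))
    reversed : StallerPath (w ∘ ρ) j′ D (w j ∷ S)
    reversed = subst (λ t → StallerPath (w ∘ ρ) j′ D (w t ∷ S)) ρ₀
                 (staller-lollipop-left oc oj′ (<-trans (n<1+n j′) (<-trans (n<1+n _) j′+2<L)) (staller-lollipop-reflect l))
    beyond : ∀ {t} → j′ < t → t < L → ¬ Core (w ∘ ρ) j′ (w (ρ t))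
    beyond j′<t t<L (s , s<j′ , eq) =
      <-irrefl (Unplayed.distinct (unplayed-reflect (unplayed l)) (<-trans s<j′ (<-trans j′<t t<L)) t<L eq) (<-trans s<j′ j′<t)
    go-reversed : ∀ {y} t → j′ < t → t < L → y ≡ w (ρ t) → y ∉ w j ∷ S → StallerWinsS G (2 + m) (y ∷ D) (w j ∷ S)
    go-reversed t j′<t t<L refl y∉S = path-win (2 + m) oj′ j′<M (staller-avoid (beyond j′<t t<L) y∉S reversed)
    onPath : ∀ y → y ∉ w j ∷ S → Core w j y → StallerWinsS G (2 + m) (y ∷ D) (w j ∷ S)
    onPath y y∉S (t , t<j , wt≡y) with y ≟ w (2 + k) | y ≟ w (1 + k)
    ... | yes eq | _ = go-reversed (1 + j′) ≤-refl (<-trans (n<1+n _) j′+2<L) (trans eq (cong w (sym ρ₁))) y∉S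
    ... | no _ | yes eq = go-reversed (2 + j′) (n≤1+n _) j′+2<L (trans eq (cong w (sym ρ₂))) y∉S
    ... | no y≢w₂ | no y≢w₁ = double-threat l (s≤s (m≤m+n c i)) j+1<L y∉S y≢w₁ y≢w₂
            λ eq → <-irrefl (distinct (<-trans t<j j<L) j+1<L (trans wt≡y eq)) (<-trans t<j (n<1+n j))

  lollipop-win-step : ∀ m {w c h p n D S} →
    (∀ {w c D S} → IsOdd c → c + h + suc (2 ^ p) ≤ 2 ^ suc m → StallerLollipop w c n D S → StallerWinsS G (suc m) D S) →
    IsOdd c → suc n ≡ h + h → 2 ^ p < h + h → h + h ≤ 2 ^ p + 2 ^ p →
    c + h + suc (2 ^ p) ≤ 2 ^ suc (suc m) → StallerLollipop w c n D S → StallerWinsS G (suc (suc m)) D S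
  lollipop-win-step m {w} {c} {h} {p} {n} {D} {S} later oc eq q<2h 2h≤2q bound l with c <? 2 ^ suc m
  ... | yes c<M with h + h ≤? 2 ^ suc m
  -- Cut at the junction: the pieces have `c` and `h + h - 1` vertices, both below `2 ^ suc m`.
  ...   | yes 2h≤M = smove (w c) (free-D c<L) (free-S c<L)
            (inj₂ (play-elsewhere (staller-lollipop-left oc oc c<L l) oc (path-win (suc m) oc c<M)
              λ y y∉S core → path-win (suc m) (double-pred-odd h eq) (subst (_≤ 2 ^ suc m) (sym eq) 2h≤M)
                               (staller-avoid (after-cut distinct core) y∉S (staller-lollipop-cycle oc l))))
    where
    open Unplayed (unplayed l)
    c<L : c < suc (c + n)
    c<L = s≤s (m≤m+n c n)
  -- The rest of the cycle is too long for a cut at the junction; the bound now ensures that both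
  -- paths around the cycle are short enough.
  ...   | no 2h≰M with cycle-cut {suc m} {c} {h} eq oc (≰⇒> 2h≰M)
                         (junction-or-cycle p (suc m) 2h≤2q (subst (c + h + suc (2 ^ p) ≤_) (2^suc (suc m)) bound) (≰⇒> 2h≰M))
  ...     | i , i′ , n≡ , 2<m , oj , j<M , j′<M = cycle-win n≡ 2<m oc (double-pred-odd h eq) oj j<M j′<M l
  -- A long stick: removing `2 ^ suc m - 1` vertices and the cut vertex lowers the measure by
  -- exactly `2 ^ suc m`, half of the bound.
  lollipop-win-step m {w} {c} {h} {p} {n} {D} {S} later oc eq q<2h 2h≤2q bound l | no c≮M
    with 2^suc-pred-odd m
  ... | j , oj , M≡ with m≤n⇒∃[o]m+o≡n (subst (_≤ c) M≡ (≮⇒≥ c≮M))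
  ...   | c′ , refl = smove (w j) (free-D j<L) (free-S j<L)
            (inj₂ (play-elsewhere (staller-lollipop-left oc oj j<L l) oj (path-win (suc m) oj (≤-reflexive (sym M≡)))
              λ y y∉S core → later (even+⁻odd (suc oj) oc) bound′
                               (avoid (after-cut (Unplayed.distinct (subst (λ L → Unplayed w L D S) (stick-length j c′ n) (unplayed l))) core)
                                      y∉S (staller-lollipop-drop j l))))
    where
    open Unplayed (unplayed l)
    j<L : j < suc (suc j + c′ + n)
    j<L = s≤s (≤-trans (n≤1+n j) (≤-trans (m≤m+n (suc j) c′) (m≤m+n (suc j + c′) n)))
    avoid : ∀ {w c n D S y} → ¬ Core w (suc (c + n)) y → y ∉ S → StallerLollipop w c n D S → StallerLollipop w c n (y ∷ D) S
    avoid ¬core y∉S l = record { unplayed = unplayed-avoid ¬core y∉S (unplayed l) ; closed = closed l }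
    arith : ∀ j c h q → suc j + c + h + suc q ≡ suc j + (c + h + suc q)
    arith = solve-∀
    bound′ : c′ + h + suc (2 ^ p) ≤ 2 ^ suc m
    bound′ = +-cancelˡ-≤ (suc j) _ _ (subst (suc j + (c′ + h + suc (2 ^ p)) ≤_) (cong (_+ 2 ^ suc m) M≡)
      (subst (suc j + (c′ + h + suc (2 ^ p)) ≤_) (2^suc (suc m)) (subst (_≤ 2 ^ (2 + m)) (arith j c′ h (2 ^ p)) bound)))

  lollipop-win : ∀ m {w c h p n D S} → IsOdd c → suc n ≡ h + h → 2 ^ p < h + h → h + h ≤ 2 ^ p + 2 ^ p →
                 c + h + suc (2 ^ p) ≤ 2 ^ m → StallerLollipop w c n D S → StallerWinsS G m D S
  lollipop-win 0 {p = p} oc _ q<2h _ bound _ = contradiction (≤-trans (lollipop-size p oc q<2h) bound) λ { (s≤s ()) }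
  lollipop-win 1 {p = p} oc _ q<2h _ bound _ = contradiction (≤-trans (lollipop-size p oc q<2h) bound) λ { (s≤s (s≤s ())) }
  lollipop-win (suc (suc m)) {h = h} {p} oc eq q<2h 2h≤2q bound =
    lollipop-win-step m {h = h} {p} (λ oc bound → lollipop-win (suc m) {h = h} {p} oc eq q<2h 2h≤2q bound) oc eq q<2h 2h≤2q bound

  -- Dominator's wins by perfect matchings and on odd cycles

  before-survive : ∀ m {w L D} → IsPath w L → IsEven L → (∀ v → Core w L v ⊎ ∃ λ u → u ∈N v × u ∈ D) →
                   ¬ StallerWinsS G m D []
  before-survive m {w} {L} {D} p eL cov = survive-forever m
    (guard-initial {T = Before L} p proj₂ before-apart (λ _ ()) λ v → [ (λ (t , t<L , eq) → inj₂ (inj₁ (paired t t<L eq))) , inj₁ ] (cov v))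
    where
    paired : ∀ {v} t → t < L → w t ≡ v → ∃₂ λ t s → Link (Before L) t s × w t ≡ v
    paired t t<L eq with before-cover t t<L
    ... | inj₁ (e , refl) = contradiction (suc e) (¬even∧odd eL)
    ... | inj₂ (s , l) = t , s , l , eq

  -- Every vertex of an odd cycle is at an even position of a suitable path through the cycle, so
  -- Dominator's first answer on the cycle leaves only pairs.
  even-stick-survive : ∀ m {w c n D S P} → IsLollipop w c n → IsEven n → 1 < n →
                       Guard D S (Core (w ∘ (c +_)) (suc n)) P → ¬ StallerWinsS G m D S
  even-stick-survive (suc m) {w} {c} {n} {D} {S} l en 1<n g =
    survive-step g (path-live round (s≤s (<-trans z<s 1<n))) (even-stick-survive m l en 1<n) onCore
    where
    round : IsPath (w ∘ (c +_)) (suc n)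
    round = path-drop c (subst (IsPath w) (sym (+-suc c n)) (walk l))
    -- Starting one vertex later makes odd positions even; the chord closes the seam.
    rot : ℕ → ℕ
    rot t = suc t % suc n
    rot-low : ∀ {t} → t < n → rot t ≡ suc t
    rot-low t<n = m<n⇒m%n≡m (s≤s t<n)
    rot-top : rot n ≡ 0
    rot-top = n%n≡0 (suc n)
    rotated : IsPath (w ∘ (c +_) ∘ rot) (suc n)
    rotated = record
      { inj = λ {s} {t} s<n t<n eq → rot-inj (m≤n⇒m<n∨m≡n (≤-pred s<n)) (m≤n⇒m<n∨m≡n (≤-pred t<n))
                                       (inj round (m%n<n (suc s) (suc n)) (m%n<n (suc t) (suc n)) eq)
      ; adj = λ {t} lt → rot-adj t (≤-pred lt) (m≤n⇒m<n∨m≡n (≤-pred lt))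
      }
      where
      rot-inj : ∀ {s t} → s < n ⊎ s ≡ n → t < n ⊎ t ≡ n → rot s ≡ rot t → s ≡ t
      rot-inj (inj₁ a) (inj₁ b) eq = suc-injective (trans (sym (rot-low a)) (trans eq (rot-low b)))
      rot-inj (inj₁ a) (inj₂ refl) eq = contradiction (trans (sym (rot-low a)) (trans eq rot-top)) λ ()
      rot-inj (inj₂ refl) (inj₁ b) eq = contradiction (trans (sym (rot-low b)) (trans (sym eq) rot-top)) λ ()
      rot-inj (inj₂ a) (inj₂ b) eq = trans a (sym b)
      rot-adj : ∀ t → suc t ≤ n → suc t < n ⊎ suc t ≡ n →
                w (c + rot (suc t)) ∈N w (c + rot t) × w (c + rot t) ∈N w (c + rot (suc t))
      rot-adj t t<n (inj₁ lt) rewrite rot-low t<n | rot-low lt = adj round (s≤s lt)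
      rot-adj t t<n (inj₂ refl) rewrite rot-low t<n | rot-top | +-identityʳ c = let (a , b) = chord l in b , a
    unrotate : ∀ {v} → Core (w ∘ (c +_) ∘ rot) (suc n) v → Core (w ∘ (c +_)) (suc n) v
    unrotate (t , _ , eq) = rot t , m%n<n (suc t) (suc n) , eq
    rotate : ∀ {v} → Core (w ∘ (c +_)) (suc n) v → Core (w ∘ (c +_) ∘ rot) (suc n) v
    rotate (zero , _ , eq) = n , ≤-refl , trans (cong (w ∘ (c +_)) rot-top) eq
    rotate (suc t , lt , eq) = t , <-trans (n<1+n t) lt , trans (cong (w ∘ (c +_)) (rot-low (≤-pred lt))) eq
    onCore : ∀ x → Core (w ∘ (c +_)) (suc n) x → x ∉ D → ¬ StallerWinsD G m D (x ∷ S)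
    onCore _ (i , i<n , refl) x∉D with even-or-odd i
    ... | inj₁ ei = survive-even round (suc en) (s≤s 1<n) ei i<n x∉D g
    onCore _ (suc i , i<n , refl) x∉D | inj₂ (suc ei) =
      subst (λ u → ¬ StallerWinsD G m D (w (c + u) ∷ S)) (rot-low (≤-pred i<n))
        (survive-even rotated (suc en) (s≤s 1<n) ei (<-trans (n<1+n i) i<n)
          (subst (λ u → w (c + u) ∉ D) (sym (rot-low (≤-pred i<n))) x∉D) (guard-core-≡ rotate unrotate g))

-- The tadpole as a lollipop

module TadpoleGame (n′ k : ℕ) (2≤n′ : 2 ≤ n′) (1≤k : 1 ≤ k) where

  n : ℕ
  n = suc n′

  open DominationGame (Tadpole n k)

  -- The Hamiltonian path u₁, …, u_k, v₀, …, v_{n-1}.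
  vertex : ℕ → V
  vertex t = (n + t) mod (n + k)

  toℕ-path : ∀ {t} → t < k → toℕ (vertex t) ≡ n + t
  toℕ-path t<k = trans (toℕ-fromℕ< _) (m<n⇒m%n≡m (+-monoʳ-< n t<k))

  toℕ-cycle : ∀ {a} → a < n → toℕ (vertex (k + a)) ≡ a
  toℕ-cycle {a} a<n = begin
    toℕ (vertex (k + a))      ≡⟨ toℕ-fromℕ< _ ⟩
    (n + (k + a)) % (n + k)   ≡⟨ cong (_% (n + k)) (trans (sym (+-assoc n k a)) (+-comm (n + k) a)) ⟩
    (a + (n + k)) % (n + k)   ≡⟨ [m+n]%n≡m%n a (n + k) ⟩
    a % (n + k)               ≡⟨ m<n⇒m%n≡m (<-≤-trans a<n (m≤m+n n k)) ⟩
    a                         ∎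
    where open ≡-Reasoning

  L : ℕ
  L = suc (k + n′)

  data Place : ℕ → Set where
    path  : ∀ {t} → t < k → Place t
    cycle : ∀ {a} → a < n → Place (k + a)

  place : ∀ t → t < L → Place t
  place t t<L with t <? k
  ... | yes t<k = path t<k
  ... | no  t≮k with m≤n⇒∃[o]m+o≡n (≮⇒≥ t≮k)
  ...   | a , refl = cycle (+-cancelˡ-< k a n (subst (k + a <_) (sym (+-suc k n′)) t<L))

  cycle-position : ∀ {t a} → t < L → toℕ (vertex t) ≡ a → a < n → t ≡ k + a
  cycle-position {t} t<L eq a<n with place t t<L
  ... | path t<k = contradiction a<n (≤⇒≯ (subst (n ≤_) (trans (sym (toℕ-path t<k)) eq) (m≤m+n n t)))
  ... | cycle b<n = cong (k +_) (trans (sym (toℕ-cycle b<n)) eq)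

  path-position : ∀ {t a} → t < L → toℕ (vertex t) ≡ a → n ≤ a → n + t ≡ a
  path-position {t} t<L eq n≤a with place t t<L
  ... | path t<k = trans (sym (toℕ-path t<k)) eq
  ... | cycle b<n = contradiction (subst (_< n) (trans (sym (toℕ-cycle b<n)) eq) b<n) (≤⇒≯ n≤a)

  vertex-injective : ∀ {s t} → s < L → t < L → vertex s ≡ vertex t → s ≡ t
  vertex-injective {s} {t} s<L t<L eq with place s s<L
  ... | path s<k = sym (+-cancelˡ-≡ n t s
    (trans (path-position t<L (sym (cong toℕ eq)) (subst (n ≤_) (sym (toℕ-path s<k)) (m≤m+n n s))) (toℕ-path s<k)))
  ... | cycle a<n = sym (cycle-position t<L (trans (sym (cong toℕ eq)) (toℕ-cycle a<n)) a<n)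

  vertex-surjective : ∀ v → Core vertex L v
  vertex-surjective v with toℕ v <? n
  ... | yes v<n = k + toℕ v , subst (k + toℕ v <_) (+-suc k n′) (+-monoʳ-< k v<n) , toℕ-injective (toℕ-cycle v<n)
  ... | no  v≮n with m≤n⇒∃[o]m+o≡n (≮⇒≥ v≮n)
  ...   | t , eq = t , <-≤-trans t<k (≤-trans (m≤m+n k n′) (n≤1+n _)) , toℕ-injective (trans (toℕ-path t<k) eq)
    where
    t<k : t < k
    t<k = +-cancelˡ-< n t k (subst (_< n + k) (sym eq) (toℕ<n v))

  -- The bridge becomes the ordinary step from `u_k` to `v₀`; only `cycWrap` joins positions that
  -- need not be consecutive, and it is the chord.
  edge-position : ∀ {s t a b} → s < L → t < L → toℕ (vertex s) ≡ a → toℕ (vertex t) ≡ b → TadEdge n k a b →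
                  t ≡ suc s ⊎ s ≡ suc t ⊎ (s ≡ k + n′ × t ≡ k)
  edge-position s<L t<L eqs eqt (cyc {a} lt) = inj₁ (trans (cycle-position t<L eqt lt)
    (trans (+-suc k a) (cong suc (sym (cycle-position s<L eqs (<-trans (n<1+n a) lt))))))
  edge-position s<L t<L eqs eqt cycWrap =
    inj₂ (inj₂ (cycle-position s<L eqs ≤-refl , trans (cycle-position t<L eqt z<s) (+-identityʳ k)))
  edge-position {s} {t} s<L t<L eqs eqt (path {a} n≤a lt) = inj₁ (+-cancelˡ-≡ n t (suc s)
    (trans (path-position t<L eqt (≤-trans n≤a (n≤1+n a))) (trans (cong suc (sym (path-position s<L eqs n≤a))) (sym (+-suc n s)))))
  edge-position {s} {t} s<L t<L eqs eqt bridge = inj₂ (inj₁ (trans (cycle-position s<L eqs z<s) (trans (+-identityʳ k)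
    (sym (+-cancelˡ-≡ n′ (suc t) k (trans (+-suc n′ t) (path-position t<L eqt (≤-trans (≤-reflexive (+-comm 1 n′)) (+-monoʳ-≤ n′ 1≤k)))))))))

  edge : ∀ {t a b} → toℕ (vertex t) ≡ a → toℕ (vertex (suc t)) ≡ b → TadEdge n k a b ⊎ TadEdge n k b a →
         vertex (suc t) ∈N vertex t × vertex t ∈N vertex (suc t)
  edge refl refl (inj₁ e) = inj₂ (inj₁ e) , inj₂ (inj₂ e)
  edge refl refl (inj₂ e) = inj₂ (inj₂ e) , inj₂ (inj₁ e)

  vertex-adjacent : ∀ t → suc t < L → vertex (suc t) ∈N vertex t × vertex t ∈N vertex (suc t)
  vertex-adjacent t lt with place t (<-trans (n<1+n t) lt)
  ... | cycle {a} a<n = edge {k + a} (toℕ-cycle a<n) (trans (cong (toℕ ∘ vertex) (sym (+-suc k a))) (toℕ-cycle a+1<n)) (inj₁ (cyc a+1<n))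
    where
    a+1<n : suc a < n
    a+1<n = s≤s (+-cancelˡ-< k a n′ (≤-pred lt))
  ... | path t<k with m≤n⇒m<n∨m≡n t<k
  ...   | inj₁ t+1<k = edge (toℕ-path t<k) (toℕ-path t+1<k)
            (inj₁ (subst (TadEdge n k (n + t)) (sym (+-suc n t)) (path (m≤m+n n t) (subst (_< n + k) (+-suc n t) (+-monoʳ-< n t+1<k)))))
  ...   | inj₂ refl = edge (trans (toℕ-path t<k) (sym (+-suc n′ t))) (trans (cong (toℕ ∘ vertex) (sym (+-identityʳ k))) (toℕ-cycle z<s)) (inj₂ bridge)

  lollipop : IsLollipop vertex k n′
  lollipop = record
    { walk = record { inj = vertex-injective ; adj = λ {t} → vertex-adjacent t }
    ; chord = closing (toℕ-cycle ≤-refl) (trans (cong (toℕ ∘ vertex) (sym (+-identityʳ k))) (toℕ-cycle z<s))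
    }
    where
    closing : ∀ {u v} → toℕ u ≡ n′ → toℕ v ≡ 0 → u ∈N v × v ∈N u
    closing eq eq′ = let e = subst (TadEdge n k _) (sym eq′) (subst (λ a → TadEdge n k a 0) (sym eq) cycWrap)
                     in inj₂ (inj₂ e) , inj₂ (inj₁ e)

  staller-lollipop : StallerLollipop vertex k n′ [] []
  staller-lollipop = record
    { unplayed = record { distinct = vertex-injective ; free-D = λ _ () ; free-S = λ _ () ; separate = λ _ () }
    ; closed = λ {t} {v} t≢k t<L v∈N → inj₂ (neighbour t≢k t<L (vertex-surjective v) v∈N)
    }
    where
    neighbour : ∀ {t v} → t ≢ k → t < L → Core vertex L v → v ∈N vertex t → Near vertex L t v ⊎ (t ≡ k + n′ × v ≡ vertex k)
    neighbour t≢k t<L _ (inj₁ refl) = inj₁ at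
    neighbour t≢k t<L (s , s<L , refl) (inj₂ (inj₁ e)) with edge-position t<L s<L refl refl e
    ... | inj₁ refl = inj₁ (next s<L)
    ... | inj₂ (inj₁ refl) = inj₁ prev
    ... | inj₂ (inj₂ (eq , refl)) = inj₂ (eq , refl)
    neighbour t≢k t<L (s , s<L , refl) (inj₂ (inj₂ e)) with edge-position s<L t<L refl refl e
    ... | inj₁ refl = inj₁ prev
    ... | inj₂ (inj₁ refl) = inj₁ (next s<L)
    ... | inj₂ (inj₂ (_ , eq)) = contradiction eq t≢k

  -- Outcomes on tadpoles

  open IsLollipop lollipop

  dominator-wins-even : IsEven L → γ'SMB-infinite (Tadpole n k)
  dominator-wins-even eL m = before-survive m walk eL (inj₁ ∘ vertex-surjective)

  -- The even stick without `v₀` is paired, and the whole odd cycle is the core.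
  dominator-wins-odd-cycle : IsEven n′ → IsEven k → γ'SMB-infinite (Tadpole n k)
  dominator-wins-odd-cycle en ek m = even-stick-survive m lollipop en 2≤n′
    (guard-initial {T = Before k} walk (λ (_ , lt) → <-trans lt k<L) before-apart outC cov)
    where
    k<L : k < L
    k<L = s≤s (m≤m+n k n′)
    outC : ∀ {s t} → Link (Before k) s t → ¬ Core (vertex ∘ (k +_)) n (vertex s)
    outC {s} l (a , a<n , eq) = <⇒≱ s<k (subst (k ≤_)
      (vertex-injective (subst (k + a <_) (+-suc k n′) (+-monoʳ-< k a<n)) (<-trans s<k k<L) eq) (m≤m+n k a))
      where
      s<k : s < k
      s<k = link-range proj₂ l
    cov : ∀ v → (∃ λ u → u ∈N v × u ∈ []) ⊎ (∃₂ λ t s → Link (Before k) t s × vertex t ≡ v) ⊎ Core (vertex ∘ (k +_)) n v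
    cov v with vertex-surjective v
    ... | t , t<L , eq with place t t<L
    ...   | cycle a<n = inj₂ (inj₂ (_ , a<n , eq))
    ...   | path t<k with before-cover t t<k
    ...     | inj₁ (e , refl) = contradiction (suc e) (¬even∧odd ek)
    ...     | inj₂ (s , l) = inj₂ (inj₁ (t , s , l , eq))

  -- Dominator opens with v₀, which also dominates v_{n-1}; the rest of the path is perfectly matched.
  dominator-first-even-cycle : IsOdd n′ → IsOdd k → γSMB-infinite (Tadpole n k)
  dominator-first-even-cycle on ok m (dmoves _ _ h) =
    before-survive m (path-take (n≤1+n _) walk) (odd+odd ok on) cov (h (vertex k) (λ ()) (λ ()))
    where
    cov : ∀ v → Core vertex (k + n′) v ⊎ ∃ λ u → u ∈N v × u ∈ vertex k ∷ []
    cov v with vertex-surjective v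
    ... | t , t<L , refl with m≤n⇒m<n∨m≡n (≤-pred t<L)
    ...   | inj₁ lt = inj₁ (t , lt , refl)
    ...   | inj₂ refl = inj₂ (vertex k , proj₂ chord , here refl)

  dominator-wins-second : ¬ (IsOdd n′ × IsOdd k) → γ'SMB-infinite (Tadpole n k)
  dominator-wins-second ¬odd with even-or-odd n′ | even-or-odd k
  ... | inj₁ en | inj₁ ek = dominator-wins-odd-cycle en ek
  ... | inj₁ en | inj₂ ok = dominator-wins-even (suc (odd+even ok en))
  ... | inj₂ on | inj₁ ek = dominator-wins-even (suc (even+odd ek on))
  ... | inj₂ on | inj₂ ok = contradiction (on , ok) ¬odd

  dominator-wins-first : γSMB-infinite (Tadpole n k)
  dominator-wins-first m with even-or-odd n′ | even-or-odd k
  ... | inj₂ on | inj₂ ok = dominator-first-even-cycle on ok m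
  ... | inj₁ en | _       = pass (dominator-wins-second (λ (on , _) → ¬even∧odd en on) m)
  ... | inj₂ _  | inj₁ ek = pass (dominator-wins-second (λ (_ , ok) → ¬even∧odd ek ok) m)

  staller-wins : IsOdd n′ → IsOdd k → γ'SMB-is (Tadpole n k) ⌈log₂ (n + k + σ n) ⌉
  staller-wins on ok with even⇒double (suc on)
  ... | h , n≡2h with half-log h (subst (3 ≤_) n≡2h (s≤s 2≤n′))
  ...   | p , q<2h , 2h≤2q , σ≡ =
      lollipop-win _ {h = h} {p} ok n≡2h q<2h 2h≤2q (subst (_≤ 2 ^ ⌈log₂ (n + k + σ n) ⌉) size (≤2^⌈log₂⌉ (n + k + σ n))) staller-lollipop
    -- If `m` is below the logarithm, then `2 ^ m` is strictly below the measure
    -- `k + h + suc (2 ^ p)`; dropping the 1 gives exactly Dominator's bound.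
    , λ m m< → lollipop-survive m {h = h} {p} lollipop ok n≡2h q<2h
        (≤-pred (subst (2 ^ m <_) (trans size (+-suc (k + h) (2 ^ p))) (≰⇒> λ le → <⇒≱ m< (≤2^⇒⌈log₂⌉≤ m le))))
        -- At the start nothing is paired and every vertex lies in the core.
        (guard-initial {T = λ _ → ⊥} walk (λ ()) (λ ()) (λ { (inj₁ ()) ; (inj₂ ()) }) (inj₂ ∘ inj₂ ∘ vertex-surjective))
    where
    arith : ∀ h k s → h + h + k + s ≡ k + h + (s + h)
    arith = solve-∀
    size : n + k + σ n ≡ k + h + suc (2 ^ p)
    size = trans (cong (λ x → x + k + σ x) n≡2h) (trans (arith h k (σ (h + h))) (cong (k + h +_) σ≡))

theorem6p2 : (n k : ℕ) → 3 ≤ n → 1 ≤ k →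
    γSMB-infinite (Tadpole n k) ×
    ((Even n × Odd k) → γ'SMB-is (Tadpole n k) ⌈log₂ (n + k + σ n) ⌉) ×
    (¬ (Even n × Odd k) → γ'SMB-infinite (Tadpole n k))
theorem6p2 (suc n′) k (s≤s 2≤n′) 1≤k =
    dominator-wins-first
  , (λ (en , ok) → staller-wins (pred-odd (Even⇒IsEven (suc n′) en)) (Odd⇒IsOdd k ok))
  , (λ ¬eo → dominator-wins-second λ (on , ok) → ¬eo (IsEven⇒Even (suc on) , IsOdd⇒Odd ok))
  where
  open TadpoleGame n′ k 2≤n′ 1≤k
  pred-odd : ∀ {m} → IsEven (suc m) → IsOdd m
  pred-odd (suc o) = o
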